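{- For every integer $m\ge 2$, $$\pi_f(K_{1,m,m})=\frac{24m}{8m+5+3/(2\lceil m/2\rceil-1)}.$$
   Context: $K_{1,m,m}$ is the complete tripartite graph with parts of sizes $1,m,m$. Two edges are nonincident if they share no endpoint. A linear ordering of $V(G)$ separates a pair of nonincident edges if both endpoints of one edge precede both endpoints of the other. $\pi_t(G)$ is the minimum length of a list of linear orderings of $V(G)$ (repetitions allowed) separating every pair of nonincident edges at least $t$ times, and the fractional separation dimension is $\pi_f(G)=\liminf_{t\to\infty}\pi_t(G)/t$. -}

module Defs where

open import Data.Nat using (ℕ; zero; suc; _+_; _*_; _∸_; _<_; _≤_; _≥_; _<ᵇ_; ⌈_/2⌉)
open import Data.Nat.Properties using (_≟_)
open import Data.Fin using (Fin; toℕ)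
open import Data.Fin.Permutation using (Permutation′; _⟨$⟩ʳ_)
open import Data.Bool using (Bool; true; false; _∧_; _∨_; if_then_else_)
open import Data.List using (List; length; filter; _∷_; [])
open import Data.Product using (Σ; _×_; _,_; ∃-syntax)
open import Data.Integer using (+_)
open import Data.Rational using (ℚ; _/_; _-_; Positive) renaming (_≤_ to _≤ℚ_; _+_ to _+ℚ_)
open import Relation.Nullary using (¬_)
open import Relation.Binary.PropositionalEquality using (_≡_)

-- Vertices of K_{1,m,m}: Fin (1 + m + m).
-- Part 0 = {0}, part 1 = {1..m}, part 2 = {m+1..2m}.
part : (m : ℕ) → Fin (1 + m + m) → ℕ
part m v with toℕ v
... | zero = 0
... | suc k = if k <ᵇ m then 1 else 2

Adj : (m : ℕ) → Fin (1 + m + m) → Fin (1 + m + m) → Set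
Adj m u v = ¬ (part m u ≡ part m v)

-- a linear ordering of V: a permutation giving each vertex its position
LinOrd : ℕ → Set
LinOrd n = Permutation′ n

pos : {n : ℕ} → LinOrd n → Fin n → ℕ
pos σ v = toℕ (σ ⟨$⟩ʳ v)

precedes : {n : ℕ} → LinOrd n → (a b c d : Fin n) → Bool
precedes σ a b c d =
  (pos σ a <ᵇ pos σ c) ∧ (pos σ a <ᵇ pos σ d) ∧ (pos σ b <ᵇ pos σ c) ∧ (pos σ b <ᵇ pos σ d)

separates : {n : ℕ} → LinOrd n → (a b c d : Fin n) → Bool
separates σ a b c d = precedes σ a b c d ∨ precedes σ c d a b

countSep : {n : ℕ} → List (LinOrd n) → (a b c d : Fin n) → ℕ
countSep [] a b c d = 0
countSep (σ ∷ L) a b c d =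
  (if separates σ a b c d then 1 else 0) + countSep L a b c d

NonincidentPair : (m : ℕ) → (a b c d : Fin (1 + m + m)) → Set
NonincidentPair m a b c d =
  Adj m a b × Adj m c d ×
  ¬ (a ≡ c) × ¬ (a ≡ d) × ¬ (b ≡ c) × ¬ (b ≡ d)

TSeparating : (m t : ℕ) → List (LinOrd (1 + m + m)) → Set
TSeparating m t L = ∀ a b c d → NonincidentPair m a b c d → t ≤ countSep L a b c d

IsPiT : (m t k : ℕ) → Set
IsPiT m t k =
  (Σ (List (LinOrd (1 + m + m))) λ L → (length L ≡ k) × TSeparating m t L) ×
  (∀ (L : List (LinOrd (1 + m + m))) → TSeparating m t L → k ≤ length L)

-- π_f(K_{1,m,m}) = q, i.e. liminf_{t→∞} π_t/t = q (t ranging over t = s+1 ≥ 1),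
-- spelled out with rational ε: π_t is well defined for every t, eventually
-- π_t/t ≥ q - ε, and infinitely often π_t/t ≤ q + ε.
FracSepDimIs : (m : ℕ) → ℚ → Set
FracSepDimIs m q =
  (∀ s → ∃[ k ] IsPiT m (suc s) k) ×
  (∀ (ε : ℚ) → Positive ε → ∃[ N ] ∀ s → N ≤ s → ∀ k → IsPiT m (suc s) k →
       (q - ε) ≤ℚ ((+ k) / suc s)) ×
  (∀ (ε : ℚ) → Positive ε → ∀ N → ∃[ s ] (N ≤ s × ∃[ k ] (IsPiT m (suc s) k ×
       ((+ k) / suc s) ≤ℚ (q +ℚ ε))))

-- 24m / (8m + 5 + 3/(2c-1)) with c = ⌈m/2⌉, written with cleared denominator:
-- 24m(2c-1) / ((8m+5)(2c-1) + 3); the denominator is written suc (… + 2).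
targetValue : ℕ → ℚ
targetValue m = (+ (24 * m * (2 * ⌈ m /2⌉ ∸ 1))) / suc ((8 * m + 5) * (2 * ⌈ m /2⌉ ∸ 1) + 2)

{-# OPTIONS --safe #-}
module Submission where

-- By symmetry only two kinds of pairs of nonincident edges matter: the hub pairs z x | y x′ and
-- z y | x y′ (z being the vertex of the part of size 1), and the rim pairs x y | x′ y′.
--
-- Lower bound: an ordering separates exactly one of u p | v q and u q | v p, unless p and q lie
-- on the same side of the interval from u to v, when it separates neither.  Hence the number of
-- quadruples {z, y, x, x′} or {z, x, y, y′} without a separated hub pair is the cost of two lattice
-- paths (the numbers of x's and y's seen so far, read from either end towards z) plus a boundary
-- term.  Its minimum is Σ_{i<m} i² − ⌊m/2⌋⌈m/2⌉, since a cheapest path stays close to the diagonal.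
--
-- Upper bound: the minimum is attained by xyxy…z…xyxy with z in the middle.  Averaging this
-- ordering over all permutations of both parts, and over the exchange of the parts, separates the
-- hub pairs equally often, and the rim pairs at least as often.

open import Defs
open import Algebra.Properties.CommutativeSemigroup using (interchange; x∙yz≈y∙xz)
open import Data.Bool using (Bool; true; false; _∧_; _∨_; if_then_else_)
open import Data.Bool.Properties using (∨-comm; ∨-identityʳ; ∧-comm; ∧-assoc; ∧-zeroʳ)
open import Data.Fin
  using (Fin; zero; suc; toℕ; fromℕ<; punchIn; punchOut; splitAt; combine; remQuot; finToFun; funToFin; _↑ˡ_
        ; _↑ʳ_)
  renaming (_≟_ to _≟ᶠ_)
open import Data.Fin.Permutation
  using (Permutation′; _⟨$⟩ʳ_; _≈_; insert; remove; insert-remove; permutation)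
  renaming (id to idₚ)
open import Data.Fin.Properties
  using (all?; any?; injective⇒≤; join-splitAt; punchInᵢ≢i; punchOut-injective; remQuot-combine
        ; finToFun-funToFin; splitAt-↑ˡ; splitAt-↑ʳ; fromℕ<-injective; toℕ-fromℕ<; toℕ-injective; toℕ-↑ˡ; toℕ-↑ʳ
        ; toℕ<n; ↑ˡ-injective; ↑ʳ-injective)
  renaming (suc-injective to suc-injectiveᶠ)
import Data.Integer as ℤ
import Data.Integer.Properties as ℤ
open import Data.List using (List; []; _∷_; _++_; concat; replicate; tabulate; lookup; length)
open import Data.List.Properties using (length-++; length-tabulate; tabulate-cong; tabulate-lookup)
open import Data.Nat hiding (_/_; _%_)
open import Data.Nat.DivMod using (_%_; [m+kn]%n≡m%n)
open import Data.Nat.Induction using (<-rec)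
open import Data.Nat.Properties
open import Data.Nat.Tactic.RingSolver using (solve-∀)
open import Data.Product using (_×_; _,_; ∃-syntax; proj₁; proj₂; uncurry)
open import Data.Rational using (_/_; _-_; Positive) renaming (_≤_ to _≤ℚ_; _+_ to _+ℚ_)
import Data.Rational.Properties as ℚ
open import Data.Rational.Unnormalised using (mkℚᵘ; *≤*)
import Data.Rational.Unnormalised.Properties as ℚᵘ
open import Data.Sum using (_⊎_; inj₁; inj₂; [_,_]′)
open import Function using (_∘_; flip)
open import Function.Bundles using (module Injection; mk⇔)
open import Function.Definitions using (Injective)
open import Function.Properties.Inverse using (↔⇒↣)
open import Relation.Binary using (tri<; tri≈; tri>)
open import Relation.Binary.PropositionalEquality
  using (_≡_; _≢_; _≗_; refl; sym; trans; cong; cong₂; subst; subst₂; module ≡-Reasoning)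
open import Relation.Nullary using (Dec; yes; no; contradiction; ¬?; _×-dec_; _→-dec_)
open import Relation.Nullary.Decidable using (map′; dec-true; dec-false; does-⇔)
open import Algebra.Properties.Semiring.Sum +-*-semiring
  using (sum; sum-syntax; sum-cong-≗; sum-remove; sum-replicate-zero; ∑-distrib-+; ∑-comm; *-distribˡ-sum
        ; *-distribʳ-sum)

private variable
  m n : ℕ

-- Separation of four numbers

[_] : Bool → ℕ
[ b ] = if b then 1 else 0

<ᵇ-true : ∀ {a b} → a < b → (a <ᵇ b) ≡ true
<ᵇ-true {a} {b} = dec-true (a <? b)

<ᵇ-false : ∀ {a b} → b ≤ a → (a <ᵇ b) ≡ false
<ᵇ-false {a} {b} b≤a = dec-false (a <? b) (≤⇒≯ b≤a)

<ᵇ-cong : ∀ {a b c d} → (a < b → c < d) → (b ≤ a → d ≤ c) → (a <ᵇ b) ≡ (c <ᵇ d)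
<ᵇ-cong {a} {b} {c} {d} to from =
  does-⇔ (mk⇔ to λ c<d → ≰⇒> λ b≤a → <⇒≱ c<d (from b≤a)) (a <? b) (c <? d)

<ᵇ-trichotomy : ∀ {a b} → a ≢ b → [ a <ᵇ b ] + [ b <ᵇ a ] ≡ 1
<ᵇ-trichotomy {a} {b} a≢b with <-cmp a b
... | tri< a<b _ _ rewrite <ᵇ-true a<b | <ᵇ-false (<⇒≤ a<b) = refl
... | tri≈ _ a≡b _ = contradiction a≡b a≢b
... | tri> _ _ b<a rewrite <ᵇ-true b<a | <ᵇ-false (<⇒≤ b<a) = refl

before : (a b c d : ℕ) → Bool
before a b c d = (a <ᵇ c) ∧ (a <ᵇ d) ∧ (b <ᵇ c) ∧ (b <ᵇ d)

sep : (a b c d : ℕ) → Bool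
sep a b c d = before a b c d ∨ before c d a b

before-flipˡ : ∀ a b c d → before a b c d ≡ before b a c d
before-flipˡ a b c d = begin
  p ∧ q ∧ r ∧ s      ≡⟨ ∧-assoc p q (r ∧ s) ⟨
  (p ∧ q) ∧ r ∧ s    ≡⟨ ∧-comm (p ∧ q) (r ∧ s) ⟩
  (r ∧ s) ∧ p ∧ q    ≡⟨ ∧-assoc r s (p ∧ q) ⟩
  r ∧ s ∧ p ∧ q      ∎
  where
  open ≡-Reasoning
  p = a <ᵇ c
  q = a <ᵇ d
  r = b <ᵇ c
  s = b <ᵇ d

before-flipʳ : ∀ a b c d → before a b c d ≡ before a b d c
before-flipʳ a b c d with a <ᵇ c | a <ᵇ d
... | false | false = refl
... | false | true  = refl
... | true  | false = refl
... | true  | true  = ∧-comm (b <ᵇ c) (b <ᵇ d)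

sep-swap : ∀ a b c d → sep a b c d ≡ sep c d a b
sep-swap a b c d = ∨-comm (before a b c d) (before c d a b)

sep-flipˡ : ∀ a b c d → sep a b c d ≡ sep b a c d
sep-flipˡ a b c d = cong₂ _∨_ (before-flipˡ a b c d) (before-flipʳ c d a b)

sep-flipʳ : ∀ a b c d → sep a b c d ≡ sep a b d c
sep-flipʳ a b c d = cong₂ _∨_ (before-flipʳ a b c d) (before-flipˡ c d a b)

sep-flips : ∀ a b c d → sep a b c d ≡ sep b a d c
sep-flips a b c d = trans (sep-flipˡ a b c d) (sep-flipʳ b a c d)

sep-cong : ∀ {a b c d a′ b′ c′ d′} → a ≡ a′ → b ≡ b′ → c ≡ c′ → d ≡ d′ → [ sep a b c d ] ≡ [ sep a′ b′ c′ d′ ]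
sep-cong refl refl refl refl = refl

sep-< : ∀ {u v} p q → u < v → sep u p v q ≡ (u <ᵇ q) ∧ (p <ᵇ v) ∧ (p <ᵇ q)
sep-< p q u<v rewrite <ᵇ-true u<v | <ᵇ-false (<⇒≤ u<v) = ∨-identityʳ _

private
  sep-dichotomy-< : ∀ {u v p q} → u < v → p ≢ v → q ≢ u → p < q →
    [ sep u p v q ] + [ sep u q v p ] + ([ p <ᵇ u ] * [ q <ᵇ u ] + [ v <ᵇ p ] * [ v <ᵇ q ]) ≡ 1
  sep-dichotomy-< {u} {v} {p} {q} u<v p≢v q≢u p<q
    rewrite sep-< p q u<v | sep-< q p u<v | <ᵇ-true p<q | <ᵇ-false (<⇒≤ p<q)
          | ∧-zeroʳ (q <ᵇ v) | ∧-zeroʳ (u <ᵇ p)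
    with <-cmp q u | <-cmp p v
  ... | tri≈ _ q≡u _ | _ = contradiction q≡u q≢u
  ... | _ | tri≈ _ p≡v _ = contradiction p≡v p≢v
  ... | tri< q<u _ _ | _
    rewrite <ᵇ-true q<u | <ᵇ-false (<⇒≤ q<u) | <ᵇ-true (<-trans p<q q<u)
          | <ᵇ-false (<⇒≤ (<-trans p<q (<-trans q<u u<v))) = refl
  ... | tri> _ _ u<q | tri< p<v _ _
    rewrite <ᵇ-true u<q | <ᵇ-true p<v | <ᵇ-false (<⇒≤ u<q) | <ᵇ-false (<⇒≤ p<v) | *-zeroʳ [ p <ᵇ u ] = refl
  ... | tri> _ _ u<q | tri> _ _ v<p
    rewrite <ᵇ-true u<q | <ᵇ-false (<⇒≤ u<q) | <ᵇ-true v<p | <ᵇ-false (<⇒≤ v<p)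
          | <ᵇ-true (<-trans v<p p<q) | *-zeroʳ [ p <ᵇ u ] = refl

sep-dichotomy : ∀ {u v p q} → u < v → p ≢ u → p ≢ v → q ≢ u → q ≢ v → p ≢ q →
  [ sep u p v q ] + [ sep u q v p ] + ([ p <ᵇ u ] * [ q <ᵇ u ] + [ v <ᵇ p ] * [ v <ᵇ q ]) ≡ 1
sep-dichotomy {u} {v} {p} {q} u<v p≢u p≢v q≢u q≢v p≢q with <-cmp p q
... | tri< p<q _ _ = sep-dichotomy-< u<v p≢v q≢u p<q
... | tri≈ _ p≡q _ = contradiction p≡q p≢q
... | tri> _ _ q<p = trans
  (exchange [ sep u p v q ] [ sep u q v p ] [ p <ᵇ u ] [ q <ᵇ u ] [ v <ᵇ p ] [ v <ᵇ q ])
  (sep-dichotomy-< u<v q≢v p≢u q<p)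
  where
  exchange : ∀ a b c d e f → a + b + (c * d + e * f) ≡ b + a + (d * c + f * e)
  exchange = solve-∀

-- Sums

∑-const : ∀ n c → ∑[ i < n ] c ≡ n * c
∑-const zero    c = refl
∑-const (suc n) c = cong (c +_) (∑-const n c)

∑-zero : {f : Fin n → ℕ} → (∀ i → f i ≡ 0) → sum f ≡ 0
∑-zero {n} f≡0 = trans (sum-cong-≗ f≡0) (sum-replicate-zero n)

∑-mono-≤ : {f g : Fin n → ℕ} → (∀ i → f i ≤ g i) → sum f ≤ sum g
∑-mono-≤ {zero}  f≤g = z≤n
∑-mono-≤ {suc n} f≤g = +-mono-≤ (f≤g zero) (∑-mono-≤ (f≤g ∘ suc))

∑-↑ : ∀ m (f : Fin (m + n) → ℕ) → sum f ≡ ∑[ i < m ] f (i ↑ˡ n) + ∑[ j < n ] f (m ↑ʳ j)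
∑-↑ zero    f = refl
∑-↑ (suc m) f = trans (cong (f zero +_) (∑-↑ m (f ∘ suc))) (sym (+-assoc (f zero) _ _))

∑-combine : ∀ m (f : Fin (m * n) → ℕ) → sum f ≡ ∑[ i < m ] ∑[ j < n ] f (combine i j)
∑-combine     zero    f = refl
∑-combine {n} (suc m) f = trans (∑-↑ n f) (cong (∑[ j < n ] f (j ↑ˡ m * n) +_) (∑-combine m (f ∘ (n ↑ʳ_))))

∑-remQuot : (f : Fin m → Fin n → ℕ) →
            ∑[ k < m * n ] uncurry f (remQuot n k) ≡ ∑[ i < m ] ∑[ j < n ] f i j
∑-remQuot {m} {n} f = trans (∑-combine m (uncurry f ∘ remQuot n))
  (sum-cong-≗ λ i → sum-cong-≗ λ j → cong (uncurry f) (remQuot-combine i j))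

∑∑-*ˡ : ∀ c (f : Fin m → Fin n → ℕ) → ∑[ i < m ] ∑[ j < n ] (c * f i j) ≡ c * ∑[ i < m ] ∑[ j < n ] f i j
∑∑-*ˡ c f = trans (sum-cong-≗ λ i → sym (*-distribˡ-sum c (f i))) (sym (*-distribˡ-sum c (sum ∘ f)))

∑∑-distrib-+ : (f g : Fin m → Fin n → ℕ) →
  ∑[ i < m ] ∑[ j < n ] (f i j + g i j) ≡ ∑[ i < m ] ∑[ j < n ] f i j + ∑[ i < m ] ∑[ j < n ] g i j
∑∑-distrib-+ f g = trans (sum-cong-≗ λ i → ∑-distrib-+ (f i) (g i)) (∑-distrib-+ (sum ∘ f) (sum ∘ g))

-- Counting ordered rather than unordered pairs avoids all divisions by two.
pairs : ℕ → ℕ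
pairs n = n * pred n

pairs+n≡n*n : ∀ n → pairs n + n ≡ n * n
pairs+n≡n*n zero    = refl
pairs+n≡n*n (suc n) = trans (+-comm (suc n * n) (suc n)) (sym (*-suc (suc n) n))

pairs-suc : ∀ n → pairs (suc n) ≡ pairs n + 2 * n
pairs-suc zero    = refl
pairs-suc (suc n) = expand n
  where
  expand : ∀ n → suc (suc n) * suc n ≡ suc n * n + 2 * suc n
  expand = solve-∀

∑≠ : (Fin n → Fin n → ℕ) → ℕ
∑≠ {zero}  f = 0
∑≠ {suc n} f = ∑[ i < suc n ] ∑[ k < n ] f i (punchIn i k)

∑≠-cong : {f g : Fin n → Fin n → ℕ} → (∀ {i j} → i ≢ j → f i j ≡ g i j) → ∑≠ f ≡ ∑≠ g
∑≠-cong {zero}  f≡g = refl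
∑≠-cong {suc n} f≡g = sum-cong-≗ λ i → sum-cong-≗ λ k → f≡g (punchInᵢ≢i i k ∘ sym)

∑≠-mono-≤ : {f g : Fin n → Fin n → ℕ} → (∀ {i j} → i ≢ j → f i j ≤ g i j) → ∑≠ f ≤ ∑≠ g
∑≠-mono-≤ {zero}  f≤g = z≤n
∑≠-mono-≤ {suc n} f≤g = ∑-mono-≤ λ i → ∑-mono-≤ λ k → f≤g (punchInᵢ≢i i k ∘ sym)

∑≠-const : ∀ n c → ∑≠ {n} (λ _ _ → c) ≡ pairs n * c
∑≠-const zero    c = refl
∑≠-const (suc n) c = begin
  ∑[ i < suc n ] ∑[ k < n ] c    ≡⟨ ∑-const (suc n) (∑[ k < n ] c) ⟩
  suc n * ∑[ k < n ] c           ≡⟨ cong (suc n *_) (∑-const n c) ⟩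
  suc n * (n * c)                ≡⟨ *-assoc (suc n) n c ⟨
  pairs (suc n) * c              ∎
  where open ≡-Reasoning

∑≠-*ˡ : ∀ c (f : Fin n → Fin n → ℕ) → ∑≠ (λ i j → c * f i j) ≡ c * ∑≠ f
∑≠-*ˡ {zero}  c f = sym (*-zeroʳ c)
∑≠-*ˡ {suc n} c f = ∑∑-*ˡ c λ i k → f i (punchIn i k)

∑≠-distrib-+ : (f g : Fin n → Fin n → ℕ) → ∑≠ (λ i j → f i j + g i j) ≡ ∑≠ f + ∑≠ g
∑≠-distrib-+ {zero}  f g = refl
∑≠-distrib-+ {suc n} f g = ∑∑-distrib-+ (λ i k → f i (punchIn i k)) (λ i k → g i (punchIn i k))

∑-∑≠-comm : (f : Fin m → Fin n → Fin n → ℕ) → ∑[ k < m ] ∑≠ (f k) ≡ ∑≠ (λ i j → ∑[ k < m ] f k i j)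
∑-∑≠-comm {m} {zero}  f = ∑-zero {m} λ _ → refl
∑-∑≠-comm {m} {suc n} f = trans (∑-comm λ k i → ∑[ l < n ] f k i (punchIn i l))
  (sum-cong-≗ λ i → ∑-comm λ k l → f k i (punchIn i l))

∑≠-∑≠-comm : (f : Fin m → Fin m → Fin n → Fin n → ℕ) →
             ∑≠ (λ i j → ∑≠ (f i j)) ≡ ∑≠ (λ k l → ∑≠ λ i j → f i j k l)
∑≠-∑≠-comm {zero}  {n} f = sym (trans (∑≠-const n 0) (*-zeroʳ (pairs n)))
∑≠-∑≠-comm {suc m} {n} f = trans (sum-cong-≗ λ i → ∑-∑≠-comm λ a → f i (punchIn i a))
  (∑-∑≠-comm λ i k l → ∑[ a < m ] f i (punchIn i a) k l)

∑≠-diagonal : (f : Fin n → Fin n → ℕ) → ∑≠ f + ∑[ i < n ] f i i ≡ ∑[ i < n ] ∑[ j < n ] f i j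
∑≠-diagonal {zero}  f = refl
∑≠-diagonal {suc n} f = begin
  ∑[ i < suc n ] offDiagonal i + ∑[ i < suc n ] f i i  ≡⟨ +-comm (sum offDiagonal) _ ⟩
  ∑[ i < suc n ] f i i + ∑[ i < suc n ] offDiagonal i  ≡⟨ ∑-distrib-+ (λ i → f i i) offDiagonal ⟨
  ∑[ i < suc n ] (f i i + offDiagonal i)               ≡⟨ sum-cong-≗ (λ i → sum-remove {i = i} (f i)) ⟨
  ∑[ i < suc n ] sum (f i)                             ∎
  where
  open ≡-Reasoning
  offDiagonal : Fin (suc n) → ℕ
  offDiagonal i = ∑[ k < n ] f i (punchIn i k)

∑≠-comm : (f : Fin n → Fin n → ℕ) → ∑≠ f ≡ ∑≠ (flip f)
∑≠-comm {n} f = +-cancelʳ-≡ (∑[ i < n ] f i i) _ _ (begin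
  ∑≠ f + ∑[ i < n ] f i i           ≡⟨ ∑≠-diagonal f ⟩
  ∑[ i < n ] ∑[ j < n ] f i j       ≡⟨ ∑-comm f ⟩
  ∑[ j < n ] ∑[ i < n ] f i j       ≡⟨ ∑≠-diagonal (flip f) ⟨
  ∑≠ (flip f) + ∑[ i < n ] f i i    ∎)
  where open ≡-Reasoning

∑≠-indicators : (p : Fin n → Bool) → ∑≠ (λ i j → [ p i ] * [ p j ]) ≡ pairs (∑[ i < n ] [ p i ])
∑≠-indicators {n} p = +-cancelʳ-≡ k _ _ (begin
  ∑≠ product + k                          ≡⟨ cong (∑≠ product +_) (sum-cong-≗ (square ∘ p)) ⟨
  ∑≠ product + ∑[ i < n ] product i i     ≡⟨ ∑≠-diagonal product ⟩
  ∑[ i < n ] ∑[ j < n ] product i j       ≡⟨ sum-cong-≗ (λ i → *-distribˡ-sum [ p i ] ([_] ∘ p)) ⟨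
  ∑[ i < n ] ([ p i ] * k)                ≡⟨ *-distribʳ-sum k ([_] ∘ p) ⟨
  k * k                                   ≡⟨ pairs+n≡n*n k ⟨
  pairs k + k                             ∎)
  where
  open ≡-Reasoning
  k = ∑[ i < n ] [ p i ]
  product : Fin n → Fin n → ℕ
  product i j = [ p i ] * [ p j ]
  square : ∀ b → [ b ] * [ b ] ≡ [ b ]
  square false = refl
  square true  = refl

∑-punchIn : (g : Fin (suc n) → ℕ) → ∑[ j < suc n ] ∑[ a < n ] g (punchIn j a) ≡ n * sum g
∑-punchIn {n} g = begin
  ∑≠ (λ j i → g i)            ≡⟨ ∑≠-comm (λ j i → g i) ⟩
  ∑[ i < suc n ] ∑[ k < n ] g i ≡⟨ sum-cong-≗ (λ i → ∑-const n (g i)) ⟩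
  ∑[ i < suc n ] (n * g i)    ≡⟨ *-distribˡ-sum n g ⟨
  n * sum g                   ∎
  where open ≡-Reasoning

∑≠-remove : ∀ j (g : Fin (suc n) → Fin (suc n) → ℕ) →
  ∑≠ g ≡ ∑[ a < n ] g j (punchIn j a) + ∑[ a < n ] g (punchIn j a) j + ∑≠ (λ a b → g (punchIn j a) (punchIn j b))
∑≠-remove {n} j g = +-cancelʳ-≡ (∑[ i < suc n ] g i i) _ _ (begin
  ∑≠ g + ∑[ i < suc n ] g i i
    ≡⟨ ∑≠-diagonal g ⟩
  ∑[ i < suc n ] sum (g i)
    ≡⟨ sum-remove {i = j} (sum ∘ g) ⟩
  sum (g j) + ∑[ a < n ] sum (g (punchIn j a))
    ≡⟨ cong₂ _+_ (sum-remove {i = j} (g j))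
         (trans (sum-cong-≗ λ a → sum-remove {i = j} (g (punchIn j a)))
                (∑-distrib-+ (λ a → g (punchIn j a) j) (λ a → ∑[ b < n ] minor a b))) ⟩
  g j j + row + (column + ∑[ a < n ] ∑[ b < n ] minor a b)
    ≡⟨ cong (λ s → g j j + row + (column + s)) (∑≠-diagonal minor) ⟨
  g j j + row + (column + (∑≠ minor + ∑[ a < n ] minor a a))
    ≡⟨ regroup (g j j) row column (∑≠ minor) (∑[ a < n ] minor a a) ⟩
  row + column + ∑≠ minor + (g j j + ∑[ a < n ] minor a a)
    ≡⟨ cong (row + column + ∑≠ minor +_) (sum-remove {i = j} λ i → g i i) ⟨
  row + column + ∑≠ minor + ∑[ i < suc n ] g i i ∎)
  where
  open ≡-Reasoning
  minor : Fin n → Fin n → ℕ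
  minor a b = g (punchIn j a) (punchIn j b)
  row = ∑[ a < n ] g j (punchIn j a)
  column = ∑[ a < n ] g (punchIn j a) j
  regroup : ∀ d r c s t → d + r + (c + (s + t)) ≡ r + c + s + (d + t)
  regroup = solve-∀

∑≠-punchIn : (g : Fin (2 + n) → Fin (2 + n) → ℕ) →
  ∑[ j < 2 + n ] ∑≠ (λ a b → g (punchIn j a) (punchIn j b)) ≡ n * ∑≠ g
∑≠-punchIn {n} g = +-cancelˡ-≡ (∑≠ g + ∑≠ g) _ _ (begin
  ∑≠ g + ∑≠ g + sum minor         ≡⟨ cong (λ s → ∑≠ g + s + sum minor) (∑≠-comm g) ⟩
  sum row + sum column + sum minor ≡⟨ cong (_+ sum minor) (∑-distrib-+ row column) ⟨
  ∑[ j < 2 + n ] (row j + column j) + sum minor ≡⟨ ∑-distrib-+ (λ j → row j + column j) minor ⟨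
  ∑[ j < 2 + n ] (row j + column j + minor j)   ≡⟨ sum-cong-≗ (λ j → ∑≠-remove j g) ⟨
  ∑[ j < 2 + n ] ∑≠ g             ≡⟨ ∑-const (2 + n) (∑≠ g) ⟩
  ∑≠ g + (∑≠ g + n * ∑≠ g)        ≡⟨ +-assoc (∑≠ g) (∑≠ g) (n * ∑≠ g) ⟨
  ∑≠ g + ∑≠ g + n * ∑≠ g          ∎)
  where
  open ≡-Reasoning
  row column minor : Fin (2 + n) → ℕ
  row j = ∑[ a < suc n ] g j (punchIn j a)
  column j = ∑[ a < suc n ] g (punchIn j a) j
  minor j = ∑≠ λ a b → g (punchIn j a) (punchIn j b)

-- Initial segments

prefixSum : (ℕ → ℕ) → ℕ → ℕ
prefixSum f zero    = 0
prefixSum f (suc n) = f n + prefixSum f n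

prefixSum-cong : ∀ {f g} → f ≗ g → ∀ n → prefixSum f n ≡ prefixSum g n
prefixSum-cong f≗g zero    = refl
prefixSum-cong f≗g (suc n) = cong₂ _+_ (f≗g n) (prefixSum-cong f≗g n)

prefixSum-+ : ∀ f g n → prefixSum (λ i → f i + g i) n ≡ prefixSum f n + prefixSum g n
prefixSum-+ f g zero    = refl
prefixSum-+ f g (suc n) = trans
  (cong (f n + g n +_) (prefixSum-+ f g n))
  (interchange +-commutativeSemigroup (f n) (g n) _ _)

prefixSum-head : ∀ f n → prefixSum f (suc n) ≡ f 0 + prefixSum (f ∘ suc) n
prefixSum-head f zero    = refl
prefixSum-head f (suc n) = trans (cong (f (suc n) +_) (prefixSum-head f n))
  (x∙yz≈y∙xz +-commutativeSemigroup (f (suc n)) (f 0) _)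

count-< : ∀ {t} → t ≤ n → ∑[ i < n ] [ toℕ i <ᵇ t ] ≡ t
count-< {n} z≤n       = ∑-zero {n} λ _ → refl
count-<     (s≤s t≤n) = cong suc (count-< t≤n)

count-≥ : ∀ n t → ∑[ i < n ] [ t <ᵇ suc (toℕ i) ] ≡ n ∸ t
count-≥ zero    t       = sym (0∸n≡0 t)
count-≥ (suc n) zero    = cong suc (count-≥ n zero)
count-≥ (suc n) (suc t) = count-≥ n t

∑-prefix : ∀ f {t} → t ≤ n → ∑[ i < n ] ([ toℕ i <ᵇ t ] * f (toℕ i)) ≡ prefixSum f t
∑-prefix {n}     f {zero}  z≤n       = ∑-zero {n} λ _ → refl
∑-prefix {suc n} f {suc t} (s≤s t≤n) =
  trans (cong₂ _+_ (*-identityˡ (f 0)) (∑-prefix (f ∘ suc) t≤n)) (sym (prefixSum-head f t))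

∑-suffix : ∀ f n t → ∑[ i < n ] ([ t <ᵇ suc (toℕ i) ] * f (n ∸ suc (toℕ i))) ≡ prefixSum f (n ∸ t)
∑-suffix f zero    t       = cong (prefixSum f) (sym (0∸n≡0 t))
∑-suffix f (suc n) zero    = cong₂ _+_ (*-identityˡ (f n)) (∑-suffix f n zero)
∑-suffix f (suc n) (suc t) = ∑-suffix f n t

∑-toℕ : ∀ f n → ∑[ i < n ] f (toℕ i) ≡ prefixSum f n
∑-toℕ f zero    = refl
∑-toℕ f (suc n) = trans (cong (f 0 +_) (∑-toℕ (f ∘ suc) n)) (sym (prefixSum-head f n))

∑-opposite : ∀ f n → ∑[ i < n ] f (n ∸ suc (toℕ i)) ≡ prefixSum f n
∑-opposite f zero    = refl
∑-opposite f (suc n) = cong (f n +_) (∑-opposite f n)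

2∑squares : ℕ → ℕ
2∑squares = prefixSum λ i → 2 * (i * i)

prefixSum-pairs : ∀ n → prefixSum (pairs ∘ suc) n + prefixSum pairs n ≡ 2∑squares n
prefixSum-pairs n = trans (sym (prefixSum-+ (pairs ∘ suc) pairs n)) (prefixSum-cong pairs-consecutive n)
  where
  pairs-consecutive : ∀ k → pairs (suc k) + pairs k ≡ 2 * (k * k)
  pairs-consecutive zero    = refl
  pairs-consecutive (suc k) = expand k
    where
    expand : ∀ k → suc (suc k) * suc k + suc k * k ≡ 2 * (suc k * suc k)
    expand = solve-∀

-- Sums over permutations

enumerate : ∀ n → Fin (n !) → Permutation′ n
enumerate zero    _ = idₚ
enumerate (suc n) k = uncurry (λ j l → insert zero j (enumerate n l)) (remQuot (n !) k)

enumerate-surjective : (σ : Permutation′ n) → ∃[ k ] enumerate n k ≈ σ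
enumerate-surjective {zero}  σ = zero , λ ()
enumerate-surjective {suc n} σ = combine (σ ⟨$⟩ʳ zero) l ,
  subst (λ (j , k) → insert zero j (enumerate n k) ≈ σ) (sym (remQuot-combine (σ ⟨$⟩ʳ zero) l)) extends
  where
  l = proj₁ (enumerate-surjective (remove zero σ))
  extends : insert zero (σ ⟨$⟩ʳ zero) (enumerate n l) ≈ σ
  extends zero    = refl
  extends (suc i) = trans (cong (punchIn (σ ⟨$⟩ʳ zero)) (proj₂ (enumerate-surjective (remove zero σ)) i))
                          (insert-remove zero σ (suc i))

∑ₚ : (Permutation′ n → ℕ) → ℕ
∑ₚ {n} f = ∑[ k < n ! ] f (enumerate n k)

∑ₚ-cong : {f g : Permutation′ n → ℕ} → (∀ π → f π ≡ g π) → ∑ₚ f ≡ ∑ₚ g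
∑ₚ-cong {n} f≡g = sum-cong-≗ (f≡g ∘ enumerate n)

∑ₚ-comm : (f : Permutation′ m → Permutation′ n → ℕ) → ∑ₚ (λ σ → ∑ₚ (f σ)) ≡ ∑ₚ (λ τ → ∑ₚ λ σ → f σ τ)
∑ₚ-comm {m} {n} f = ∑-comm λ k l → f (enumerate m k) (enumerate n l)

∑ₚ-insert : (f : Permutation′ (suc n) → ℕ) → ∑ₚ f ≡ ∑[ j < suc n ] ∑ₚ (f ∘ insert zero j)
∑ₚ-insert {n} f = ∑-remQuot λ j l → f (insert zero j (enumerate n l))

∑ₚ-eval : (g : Fin (suc n) → ℕ) → ∀ i → ∑ₚ (λ π → g (π ⟨$⟩ʳ i)) ≡ n ! * sum g
∑ₚ-eval {n} g zero = begin
  ∑ₚ (λ π → g (π ⟨$⟩ʳ zero))           ≡⟨ ∑ₚ-insert (λ π → g (π ⟨$⟩ʳ zero)) ⟩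
  ∑[ j < suc n ] ∑[ l < n ! ] g j      ≡⟨ sum-cong-≗ (λ j → ∑-const (n !) (g j)) ⟩
  ∑[ j < suc n ] (n ! * g j)           ≡⟨ *-distribˡ-sum (n !) g ⟨
  n ! * sum g                          ∎
  where open ≡-Reasoning
∑ₚ-eval {suc n} g (suc i) = begin
  ∑ₚ (λ π → g (π ⟨$⟩ʳ suc i))
    ≡⟨ ∑ₚ-insert (λ π → g (π ⟨$⟩ʳ suc i)) ⟩
  ∑[ j < 2 + n ] ∑ₚ (λ π → g (punchIn j (π ⟨$⟩ʳ i)))
    ≡⟨ sum-cong-≗ (λ j → ∑ₚ-eval (g ∘ punchIn j) i) ⟩
  ∑[ j < 2 + n ] (n ! * ∑[ a < suc n ] g (punchIn j a))
    ≡⟨ *-distribˡ-sum (n !) (λ j → ∑[ a < suc n ] g (punchIn j a)) ⟨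
  n ! * ∑[ j < 2 + n ] ∑[ a < suc n ] g (punchIn j a)
    ≡⟨ cong (n ! *_) (∑-punchIn g) ⟩
  n ! * (suc n * sum g)
    ≡⟨ regroup (n !) (suc n) (sum g) ⟩
  suc n ! * sum g ∎
  where
  open ≡-Reasoning
  regroup : ∀ a b c → a * (b * c) ≡ b * a * c
  regroup = solve-∀

private
  ∑ₚ-eval₂-zero : (g : Fin (2 + n) → Fin (2 + n) → ℕ) → ∀ j →
    ∑ₚ (λ π → g (π ⟨$⟩ʳ zero) (π ⟨$⟩ʳ suc j)) ≡ n ! * ∑≠ g
  ∑ₚ-eval₂-zero {n} g j = begin
    ∑ₚ (λ π → g (π ⟨$⟩ʳ zero) (π ⟨$⟩ʳ suc j))
      ≡⟨ ∑ₚ-insert (λ π → g (π ⟨$⟩ʳ zero) (π ⟨$⟩ʳ suc j)) ⟩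
    ∑[ a < 2 + n ] ∑ₚ (λ π → g a (punchIn a (π ⟨$⟩ʳ j)))
      ≡⟨ sum-cong-≗ (λ a → ∑ₚ-eval (g a ∘ punchIn a) j) ⟩
    ∑[ a < 2 + n ] (n ! * ∑[ b < suc n ] g a (punchIn a b))
      ≡⟨ *-distribˡ-sum (n !) (λ a → ∑[ b < suc n ] g a (punchIn a b)) ⟨
    n ! * ∑≠ g ∎
    where open ≡-Reasoning

∑ₚ-eval₂ : (g : Fin (2 + n) → Fin (2 + n) → ℕ) → ∀ {i j} → i ≢ j →
           ∑ₚ (λ π → g (π ⟨$⟩ʳ i) (π ⟨$⟩ʳ j)) ≡ n ! * ∑≠ g
∑ₚ-eval₂     g {zero}  {zero}  i≢j = contradiction refl i≢j
∑ₚ-eval₂     g {zero}  {suc j} i≢j = ∑ₚ-eval₂-zero g j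
∑ₚ-eval₂ {n} g {suc i} {zero}  i≢j = trans (∑ₚ-eval₂-zero (flip g) i) (cong (n ! *_) (sym (∑≠-comm g)))
∑ₚ-eval₂ {zero}  g {suc zero} {suc zero} i≢j = contradiction refl i≢j
∑ₚ-eval₂ {suc n} g {suc i} {suc j} i≢j = begin
  ∑ₚ (λ π → g (π ⟨$⟩ʳ suc i) (π ⟨$⟩ʳ suc j))
    ≡⟨ ∑ₚ-insert (λ π → g (π ⟨$⟩ʳ suc i) (π ⟨$⟩ʳ suc j)) ⟩
  ∑[ a < 3 + n ] ∑ₚ (λ π → g (punchIn a (π ⟨$⟩ʳ i)) (punchIn a (π ⟨$⟩ʳ j)))
    ≡⟨ sum-cong-≗ (λ a → ∑ₚ-eval₂ (λ b c → g (punchIn a b) (punchIn a c)) (i≢j ∘ cong suc)) ⟩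
  ∑[ a < 3 + n ] (n ! * minor a)
    ≡⟨ *-distribˡ-sum (n !) minor ⟨
  n ! * sum minor
    ≡⟨ cong (n ! *_) (∑≠-punchIn g) ⟩
  n ! * (suc n * ∑≠ g)
    ≡⟨ regroup (n !) (suc n) (∑≠ g) ⟩
  suc n ! * ∑≠ g ∎
  where
  open ≡-Reasoning
  minor : Fin (3 + n) → ℕ
  minor a = ∑≠ λ b c → g (punchIn a b) (punchIn a c)
  regroup : ∀ a b c → a * (b * c) ≡ b * a * c
  regroup = solve-∀

-- Hub pairs and rim pairs

below above : (Fin n → ℕ) → ℕ → ℕ
below {n} p t = ∑[ i < n ] [ p i <ᵇ t ]
above {n} p t = ∑[ i < n ] [ t <ᵇ p i ]

Avoids : (Fin n → ℕ) → ℕ → Set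
Avoids p t = ∀ i → p i ≢ t

below+above : {p : Fin n → ℕ} → ∀ {t} → Avoids p t → below p t + above p t ≡ n
below+above {n} {p} {t} p≢t = begin
  below p t + above p t                       ≡⟨ ∑-distrib-+ (λ i → [ p i <ᵇ t ]) (λ i → [ t <ᵇ p i ]) ⟨
  ∑[ i < n ] ([ p i <ᵇ t ] + [ t <ᵇ p i ])    ≡⟨ sum-cong-≗ (<ᵇ-trichotomy ∘ p≢t) ⟩
  ∑[ i < n ] 1                                ≡⟨ ∑-const n 1 ⟩
  n * 1                                       ≡⟨ *-identityʳ n ⟩
  n                                           ∎
  where open ≡-Reasoning

crossings outside : ℕ → ℕ → (Fin n → ℕ) → ℕ
crossings u v p = ∑≠ λ i j → [ sep u (p i) v (p j) ]
outside   u v p = [ u <ᵇ v ] * (pairs (below p u) + pairs (above p v))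

crossings-comm : ∀ u v (p : Fin n → ℕ) → crossings u v p ≡ crossings v u p
crossings-comm u v p = trans (∑≠-comm λ i j → [ sep u (p i) v (p j) ])
  (∑≠-cong λ {i} {j} _ → cong [_] (sep-swap u (p j) v (p i)))

outside-< : ∀ {u v} (p : Fin n → ℕ) → u < v → outside u v p ≡ pairs (below p u) + pairs (above p v)
outside-< {u = u} {v} p u<v = trans
  (cong (λ b → [ b ] * (pairs (below p u) + pairs (above p v))) (<ᵇ-true u<v)) (*-identityˡ _)

outside-≥ : ∀ {u v} (p : Fin n → ℕ) → v ≤ u → outside u v p ≡ 0
outside-≥ {u = u} {v} p v≤u = cong (λ b → [ b ] * (pairs (below p u) + pairs (above p v))) (<ᵇ-false v≤u)

private
  crossings-< : ∀ {u v} {p : Fin n → ℕ} → Injective _≡_ _≡_ p → Avoids p u → Avoids p v → u < v →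
                2 * crossings u v p + (pairs (below p u) + pairs (above p v)) ≡ pairs n
  crossings-< {n} {u} {v} {p} p-inj p≢u p≢v u<v = begin
    2 * crossings u v p + (pairs (below p u) + pairs (above p v))
      ≡⟨ cong₂ (λ s t → crossings u v p + s + t)
           (trans (+-identityʳ _) (∑≠-comm cross))
           (cong₂ _+_ (sym (∑≠-indicators (λ i → p i <ᵇ u))) (sym (∑≠-indicators (λ i → v <ᵇ p i)))) ⟩
    ∑≠ cross + ∑≠ (flip cross) + (∑≠ both< + ∑≠ both>)
      ≡⟨ cong₂ _+_ (∑≠-distrib-+ cross (flip cross)) (∑≠-distrib-+ both< both>) ⟨
    ∑≠ (λ i j → cross i j + cross j i) + ∑≠ (λ i j → both< i j + both> i j)
      ≡⟨ ∑≠-distrib-+ (λ i j → cross i j + cross j i) (λ i j → both< i j + both> i j) ⟨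
    ∑≠ (λ i j → cross i j + cross j i + (both< i j + both> i j))
      ≡⟨ ∑≠-cong (λ {i} {j} i≢j → sep-dichotomy u<v (p≢u i) (p≢v i) (p≢u j) (p≢v j) (i≢j ∘ p-inj)) ⟩
    ∑≠ {n} (λ _ _ → 1)
      ≡⟨ ∑≠-const n 1 ⟩
    pairs n * 1
      ≡⟨ *-identityʳ (pairs n) ⟩
    pairs n ∎
    where
    open ≡-Reasoning
    cross both< both> : Fin n → Fin n → ℕ
    cross i j = [ sep u (p i) v (p j) ]
    both< i j = [ p i <ᵇ u ] * [ p j <ᵇ u ]
    both> i j = [ v <ᵇ p i ] * [ v <ᵇ p j ]

crossings+outside : ∀ {u v} {p : Fin n → ℕ} → Injective _≡_ _≡_ p → Avoids p u → Avoids p v → u ≢ v →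
                    2 * crossings u v p + (outside u v p + outside v u p) ≡ pairs n
crossings+outside {n} {u} {v} {p} p-inj p≢u p≢v u≢v with <-cmp u v
... | tri≈ _ u≡v _ = contradiction u≡v u≢v
... | tri< u<v _ _ = trans
  (cong (2 * crossings u v p +_) (trans (cong₂ _+_ (outside-< p u<v) (outside-≥ p (<⇒≤ u<v))) (+-identityʳ _)))
  (crossings-< p-inj p≢u p≢v u<v)
... | tri> _ _ v<u = trans
  (cong₂ (λ s t → 2 * s + t) (crossings-comm u v p) (cong₂ _+_ (outside-≥ p (<⇒≤ v<u)) (outside-< p v<u)))
  (crossings-< p-inj p≢v p≢u v<u)

-- Positions of the vertices of K_{1,m,m} in a linear ordering: z for the part of size 1,
-- x and y for the parts of size m.
record Layout (m : ℕ) : Set where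
  field
    z           : ℕ
    x y         : Fin m → ℕ
    x-injective : Injective _≡_ _≡_ x
    y-injective : Injective _≡_ _≡_ y
    x≢y         : ∀ i j → x i ≢ y j
    x≢z         : Avoids x z
    y≢z         : Avoids y z
    bound       : ℕ
    x≤bound     : ∀ i → x i ≤ bound
    y≤bound     : ∀ i → y i ≤ bound
    z≤bound     : z ≤ bound

swapParts : Layout m → Layout m
swapParts ℓ = record
  { z = z ; x = y ; y = x ; x-injective = y-injective ; y-injective = x-injective
  ; x≢y = λ i j → x≢y j i ∘ sym ; x≢z = y≢z ; y≢z = x≢z
  ; bound = bound ; x≤bound = y≤bound ; y≤bound = x≤bound ; z≤bound = z≤bound }
  where open Layout ℓ

reverse : Layout m → Layout m
reverse ℓ = record
  { z = bound ∸ z ; x = λ i → bound ∸ x i ; y = λ j → bound ∸ y j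
  ; x-injective = λ {i} {j} → x-injective ∘ ∸-cancelˡ-≡ (x≤bound i) (x≤bound j)
  ; y-injective = λ {i} {j} → y-injective ∘ ∸-cancelˡ-≡ (y≤bound i) (y≤bound j)
  ; x≢y = λ i j → x≢y i j ∘ ∸-cancelˡ-≡ (x≤bound i) (y≤bound j)
  ; x≢z = λ i → x≢z i ∘ ∸-cancelˡ-≡ (x≤bound i) z≤bound
  ; y≢z = λ j → y≢z j ∘ ∸-cancelˡ-≡ (y≤bound j) z≤bound
  ; bound = bound ; x≤bound = m∸n≤m bound ∘ x ; y≤bound = m∸n≤m bound ∘ y ; z≤bound = m∸n≤m bound z }
  where open Layout ℓ

pairsUnder : (Fin m → ℕ) → (Fin n → ℕ) → ℕ → ℕ
pairsUnder {n = n} x y t = ∑[ j < n ] ([ y j <ᵇ t ] * pairs (below x (y j)))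

∸-reverses-<ᵇ : ∀ {a b c} → a ≤ c → b ≤ c → (c ∸ a <ᵇ c ∸ b) ≡ (b <ᵇ a)
∸-reverses-<ᵇ {c = c} a≤c b≤c = sym (<ᵇ-cong (λ b<a → ∸-monoʳ-< b<a a≤c) (∸-monoʳ-≤ c))

∑-*-distribˡ-+ : (f g : Fin n → ℕ) → ∀ c → ∑[ i < n ] (f i * (g i + c)) ≡ ∑[ i < n ] (f i * g i) + sum f * c
∑-*-distribˡ-+ {n} f g c = begin
  ∑[ i < n ] (f i * (g i + c))                        ≡⟨ sum-cong-≗ (λ i → *-distribˡ-+ (f i) (g i) c) ⟩
  ∑[ i < n ] (f i * g i + f i * c)                    ≡⟨ ∑-distrib-+ (λ i → f i * g i) (λ i → f i * c) ⟩
  ∑[ i < n ] (f i * g i) + ∑[ i < n ] (f i * c)       ≡⟨ cong (∑[ i < n ] (f i * g i) +_) (*-distribʳ-sum c f) ⟨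
  ∑[ i < n ] (f i * g i) + sum f * c                  ∎
  where open ≡-Reasoning

module _ (ℓ : Layout m) where
  open Layout ℓ
  private module ℓʳ = Layout (reverse ℓ)

  below-reverse : ∀ {p : Fin n → ℕ} {t} → (∀ i → p i ≤ bound) → t ≤ bound →
                  below (λ i → bound ∸ p i) (bound ∸ t) ≡ above p t
  below-reverse p≤bound t≤bound = sum-cong-≗ λ i → cong [_] (∸-reverses-<ᵇ (p≤bound i) t≤bound)

  pairsUnder-reverse : pairsUnder ℓʳ.x ℓʳ.y ℓʳ.z ≡ ∑[ j < m ] ([ z <ᵇ y j ] * pairs (above x (y j)))
  pairsUnder-reverse = sum-cong-≗ λ j → cong₂ (λ b k → [ b ] * pairs k)
    (∸-reverses-<ᵇ (y≤bound j) z≤bound) (below-reverse x≤bound (y≤bound j))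

  spokeCrossings : ℕ
  spokeCrossings = ∑[ j < m ] crossings z (y j) x

  spokeCrossings-count :
    2 * spokeCrossings + (pairsUnder x y z + pairsUnder ℓʳ.x ℓʳ.y ℓʳ.z
      + (below y z * pairs (above x z) + above y z * pairs (below x z)))
    ≡ m * pairs m
  spokeCrossings-count = begin
    2 * spokeCrossings + (pairsUnder x y z + pairsUnder ℓʳ.x ℓʳ.y ℓʳ.z + (belowTerm + aboveTerm))
      ≡⟨ cong₂ (λ s t → s + (pairsUnder x y z + t + (belowTerm + aboveTerm)))
           (*-distribˡ-sum 2 cross) pairsUnder-reverse ⟩
    ∑[ j < m ] (2 * cross j) + (pairsUnder x y z + pairsOver + (belowTerm + aboveTerm))
      ≡⟨ cong (∑[ j < m ] (2 * cross j) +_) (regroup (pairsUnder x y z) pairsOver belowTerm aboveTerm) ⟩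
    ∑[ j < m ] (2 * cross j) + ((pairsOver + aboveTerm) + (pairsUnder x y z + belowTerm))
      ≡⟨ cong (∑[ j < m ] (2 * cross j) +_) (cong₂ _+_ outside-above outside-below) ⟨
    ∑[ j < m ] (2 * cross j) + (∑[ j < m ] outside z (y j) x + ∑[ j < m ] outside (y j) z x)
      ≡⟨ cong (∑[ j < m ] (2 * cross j) +_) (∑-distrib-+ (λ j → outside z (y j) x) (λ j → outside (y j) z x)) ⟨
    ∑[ j < m ] (2 * cross j) + ∑[ j < m ] (outside z (y j) x + outside (y j) z x)
      ≡⟨ ∑-distrib-+ (λ j → 2 * cross j) (λ j → outside z (y j) x + outside (y j) z x) ⟨
    ∑[ j < m ] (2 * cross j + (outside z (y j) x + outside (y j) z x))
      ≡⟨ sum-cong-≗ (λ j → crossings+outside x-injective x≢z (λ i → x≢y i j) (y≢z j ∘ sym)) ⟩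
    ∑[ j < m ] pairs m
      ≡⟨ ∑-const m (pairs m) ⟩
    m * pairs m ∎
    where
    open ≡-Reasoning
    cross : Fin m → ℕ
    cross j = crossings z (y j) x
    pairsOver = ∑[ j < m ] ([ z <ᵇ y j ] * pairs (above x (y j)))
    aboveTerm = above y z * pairs (below x z)
    belowTerm = below y z * pairs (above x z)
    outside-above : ∑[ j < m ] outside z (y j) x ≡ pairsOver + aboveTerm
    outside-above = trans
      (sum-cong-≗ λ j → cong ([ z <ᵇ y j ] *_) (+-comm (pairs (below x z)) (pairs (above x (y j)))))
      (∑-*-distribˡ-+ (λ j → [ z <ᵇ y j ]) (λ j → pairs (above x (y j))) (pairs (below x z)))
    outside-below : ∑[ j < m ] outside (y j) z x ≡ pairsUnder x y z + belowTerm
    outside-below = ∑-*-distribˡ-+ (λ j → [ y j <ᵇ z ]) (λ j → pairs (below x (y j))) (pairs (above x z))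
    regroup : ∀ u o b a → u + o + (b + a) ≡ o + a + (u + b)
    regroup = solve-∀

walkCost : (Fin m → ℕ) → (Fin n → ℕ) → ℕ → ℕ
walkCost x y t = pairsUnder x y t + pairsUnder y x t

boundaryCost : (a b a′ b′ : ℕ) → ℕ
boundaryCost a b a′ b′ = b * pairs a′ + b′ * pairs a + (a * pairs b′ + a′ * pairs b)

module _ (ℓ : Layout m) where
  open Layout ℓ
  private module ℓʳ = Layout (reverse ℓ)

  hubCrossings : ℕ
  hubCrossings = spokeCrossings ℓ + spokeCrossings (swapParts ℓ)

  defect : ℕ
  defect = walkCost x y z + walkCost ℓʳ.x ℓʳ.y ℓʳ.z + boundaryCost (below x z) (below y z) (above x z) (above y z)

  hubCrossings+defect : 2 * hubCrossings + defect ≡ 2 * (m * pairs m)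
  hubCrossings+defect = trans
    (regroup (spokeCrossings ℓ) (spokeCrossings (swapParts ℓ)) (pairsUnder x y z) (pairsUnder y x z)
      (pairsUnder ℓʳ.x ℓʳ.y ℓʳ.z) (pairsUnder ℓʳ.y ℓʳ.x ℓʳ.z) _ _)
    (cong₂ _+_ (spokeCrossings-count ℓ) (trans (spokeCrossings-count (swapParts ℓ)) (sym (+-identityʳ _))))
    where
    regroup : ∀ p q a b c d e f → 2 * (p + q) + (a + b + (c + d) + (e + f))
                                ≡ 2 * p + (a + c + e) + (2 * q + (b + d + f))
    regroup = solve-∀

rimCrossings : Layout m → ℕ
rimCrossings ℓ = ∑≠ λ i j → crossings (x i) (x j) y
  where open Layout ℓ

rimCrossings-swapParts : (ℓ : Layout m) → rimCrossings (swapParts ℓ) ≡ rimCrossings ℓ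
rimCrossings-swapParts ℓ = trans (∑≠-∑≠-comm λ k l i j → [ sep (y k) (x i) (y l) (x j) ])
  (∑≠-cong λ {i} {j} _ → ∑≠-cong λ {k} {l} _ → cong [_] (sep-flips (y k) (x i) (y l) (x j)))
  where open Layout ℓ

rimCrossings+outside : (ℓ : Layout m) → let open Layout ℓ in
  2 * rimCrossings ℓ + 2 * ∑≠ (λ i j → outside (x i) (x j) y) ≡ pairs m * pairs m
rimCrossings+outside {m} ℓ = begin
  2 * ∑≠ cross + 2 * ∑≠ outer
    ≡⟨ cong₂ _+_ (sym (∑≠-*ˡ 2 cross)) (cong (∑≠ outer +_) (trans (+-identityʳ (∑≠ outer)) (∑≠-comm outer))) ⟩
  ∑≠ (λ i j → 2 * cross i j) + (∑≠ outer + ∑≠ (flip outer))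
    ≡⟨ cong (∑≠ (λ i j → 2 * cross i j) +_) (∑≠-distrib-+ outer (flip outer)) ⟨
  ∑≠ (λ i j → 2 * cross i j) + ∑≠ (λ i j → outer i j + outer j i)
    ≡⟨ ∑≠-distrib-+ (λ i j → 2 * cross i j) (λ i j → outer i j + outer j i) ⟨
  ∑≠ (λ i j → 2 * cross i j + (outer i j + outer j i))
    ≡⟨ ∑≠-cong (λ {i} {j} i≢j → crossings+outside y-injective (λ k → x≢y i k ∘ sym) (λ k → x≢y j k ∘ sym)
                                  (i≢j ∘ x-injective)) ⟩
  ∑≠ {m} (λ _ _ → pairs m)
    ≡⟨ ∑≠-const m (pairs m) ⟩
  pairs m * pairs m ∎
  where
  open ≡-Reasoning
  open Layout ℓ
  cross outer : Fin m → Fin m → ℕ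
  cross i j = crossings (x i) (x j) y
  outer i j = outside (x i) (x j) y

-- Lattice paths

-- A monotone lattice path pays pairs b for a step (a , b) → (suc a , b) and pairs a for a step
-- (a , b) → (a , suc b); pathCost a b is the least cost of a path from the origin to (a , b).
pathCost : ℕ → ℕ → ℕ
pathCost a       zero    = 0
pathCost zero    (suc b) = 0
pathCost (suc a) (suc b) = pathCost a b + 2 * (b * a)

pathCost-comm : ∀ a b → pathCost a b ≡ pathCost b a
pathCost-comm zero    zero    = refl
pathCost-comm zero    (suc b) = refl
pathCost-comm (suc a) zero    = refl
pathCost-comm (suc a) (suc b) = cong₂ (λ c k → c + 2 * k) (pathCost-comm a b) (*-comm b a)

pathCost-step : ∀ a b → pathCost a (suc b) ≤ pathCost a b + pairs a
pathCost-step zero    b       = z≤n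
pathCost-step (suc a) zero    = z≤n
pathCost-step (suc a) (suc b) = begin
  pathCost a (suc b) + 2 * (suc b * a)          ≤⟨ +-monoˡ-≤ (2 * (suc b * a)) (pathCost-step a b) ⟩
  pathCost a b + pairs a + 2 * (suc b * a)      ≡⟨ regroup (pathCost a b) (pairs a) a b ⟩
  pathCost a b + 2 * (b * a) + (pairs a + 2 * a) ≡⟨ cong (pathCost a b + 2 * (b * a) +_) (pairs-suc a) ⟨
  pathCost a b + 2 * (b * a) + pairs (suc a)    ∎
  where
  open ≤-Reasoning
  regroup : ∀ c k a b → c + k + 2 * (suc b * a) ≡ c + 2 * (b * a) + (k + 2 * a)
  regroup = solve-∀

<ᵇ-suc-≢ : ∀ {a t} → a ≢ t → (a <ᵇ suc t) ≡ (a <ᵇ t)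
<ᵇ-suc-≢ a≢t = sym (<ᵇ-cong m<n⇒m<1+n λ t≤a → ≤∧≢⇒< t≤a (a≢t ∘ sym))

∑-<ᵇ-suc-avoids : {p : Fin n → ℕ} (f : Bool → Fin n → ℕ) → ∀ {t} → Avoids p t →
  ∑[ i < n ] f (p i <ᵇ suc t) i ≡ ∑[ i < n ] f (p i <ᵇ t) i
∑-<ᵇ-suc-avoids f p≢t = sum-cong-≗ λ i → cong (λ b → f b i) (<ᵇ-suc-≢ (p≢t i))

∑-<ᵇ-suc-hits : {p : Fin n → ℕ} (f : Bool → Fin n → ℕ) → Injective _≡_ _≡_ p → ∀ i → f false i ≡ 0 →
  ∑[ j < n ] f (p j <ᵇ suc (p i)) j ≡ f true i + ∑[ j < n ] f (p j <ᵇ p i) j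
∑-<ᵇ-suc-hits {suc n} {p} f p-inj i fi≡0 = begin
  ∑[ j < suc n ] f (p j <ᵇ suc (p i)) j
    ≡⟨ sum-remove {i = i} (λ j → f (p j <ᵇ suc (p i)) j) ⟩
  f (p i <ᵇ suc (p i)) i + ∑[ k < n ] f (p (others k) <ᵇ suc (p i)) (others k)
    ≡⟨ cong₂ _+_ (cong (λ b → f b i) (<ᵇ-true (n<1+n (p i))))
         (∑-<ᵇ-suc-avoids (λ b → f b ∘ others) λ k → punchInᵢ≢i i k ∘ p-inj) ⟩
  f true i + ∑[ k < n ] f (p (others k) <ᵇ p i) (others k)
    ≡⟨ cong (λ s → f true i + (s + ∑[ k < n ] f (p (others k) <ᵇ p i) (others k)))
         (trans (cong (λ b → f b i) (<ᵇ-false (≤-refl {p i}))) fi≡0) ⟨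
  f true i + (f (p i <ᵇ p i) i + ∑[ k < n ] f (p (others k) <ᵇ p i) (others k))
    ≡⟨ cong (f true i +_) (sum-remove {i = i} (λ j → f (p j <ᵇ p i) j)) ⟨
  f true i + ∑[ j < suc n ] f (p j <ᵇ p i) j ∎
  where
  open ≡-Reasoning
  others : Fin n → Fin (suc n)
  others = punchIn i

below-suc-avoids : {p : Fin n → ℕ} → ∀ {t} → Avoids p t → below p (suc t) ≡ below p t
below-suc-avoids = ∑-<ᵇ-suc-avoids λ b _ → [ b ]

below-suc-hits : {p : Fin n → ℕ} → Injective _≡_ _≡_ p → ∀ i → below p (suc (p i)) ≡ suc (below p (p i))
below-suc-hits p-inj i = ∑-<ᵇ-suc-hits (λ b _ → [ b ]) p-inj i refl

pairsUnder-suc-avoids : (x : Fin m → ℕ) {y : Fin n → ℕ} → ∀ {t} → Avoids y t →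
                        pairsUnder x y (suc t) ≡ pairsUnder x y t
pairsUnder-suc-avoids x {y} = ∑-<ᵇ-suc-avoids λ b j → [ b ] * pairs (below x (y j))

pairsUnder-suc-hits : (x : Fin m → ℕ) {y : Fin n → ℕ} → Injective _≡_ _≡_ y → ∀ j →
                      pairsUnder x y (suc (y j)) ≡ pairs (below x (y j)) + pairsUnder x y (y j)
pairsUnder-suc-hits x {y} y-inj j = trans
  (∑-<ᵇ-suc-hits (λ b k → [ b ] * pairs (below x (y k))) y-inj j refl)
  (cong (_+ pairsUnder x y (y j)) (*-identityˡ (pairs (below x (y j)))))

PathBound : (Fin m → ℕ) → (Fin n → ℕ) → ℕ → Set
PathBound x y t = pathCost (below x t) (below y t) ≤ walkCost x y t

pathBound-sym : (x : Fin m → ℕ) (y : Fin n → ℕ) → ∀ t → PathBound x y t → PathBound y x t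
pathBound-sym x y t = subst₂ _≤_
  (pathCost-comm (below x t) (below y t))
  (+-comm (pairsUnder x y t) (pairsUnder y x t))

pathBound-suc-avoids : {x : Fin m → ℕ} {y : Fin n → ℕ} → ∀ {t} → Avoids x t → Avoids y t →
                       PathBound x y t → PathBound x y (suc t)
pathBound-suc-avoids {x = x} {y} {t} x≢t y≢t = subst₂ _≤_
  (cong₂ pathCost (sym (below-suc-avoids x≢t)) (sym (below-suc-avoids y≢t)))
  (cong₂ _+_ (sym (pairsUnder-suc-avoids x y≢t)) (sym (pairsUnder-suc-avoids y x≢t)))

pathBound-suc-hits : {x : Fin m → ℕ} {y : Fin n → ℕ} → Injective _≡_ _≡_ y → ∀ j → Avoids x (y j) →
                     PathBound x y (y j) → PathBound x y (suc (y j))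
pathBound-suc-hits {x = x} {y} y-inj j x≢yⱼ bound = begin
  pathCost (below x (suc t)) (below y (suc t))
    ≡⟨ cong₂ pathCost (below-suc-avoids x≢yⱼ) (below-suc-hits y-inj j) ⟩
  pathCost (below x t) (suc (below y t))
    ≤⟨ pathCost-step (below x t) (below y t) ⟩
  pathCost (below x t) (below y t) + new
    ≤⟨ +-monoˡ-≤ new bound ⟩
  walkCost x y t + new
    ≡⟨ regroup (pairsUnder x y t) (pairsUnder y x t) new ⟩
  new + pairsUnder x y t + pairsUnder y x t
    ≡⟨ cong₂ _+_ (pairsUnder-suc-hits x y-inj j) (pairsUnder-suc-avoids y x≢yⱼ) ⟨
  walkCost x y (suc t) ∎
  where
  open ≤-Reasoning
  t = y j
  new = pairs (below x t)
  regroup : ∀ p q r → p + q + r ≡ r + p + q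
  regroup = solve-∀

pathCost≤walkCost : {x : Fin m → ℕ} {y : Fin n → ℕ} → Injective _≡_ _≡_ x → Injective _≡_ _≡_ y →
                    (∀ i j → x i ≢ y j) → ∀ t → PathBound x y t
pathCost≤walkCost {m} {n} {x} {y} x-inj y-inj x≢y zero
  rewrite ∑-zero {n} {λ j → [ y j <ᵇ 0 ]} (λ _ → refl) = z≤n
pathCost≤walkCost {m} {n} {x} {y} x-inj y-inj x≢y (suc t)
  with pathCost≤walkCost x-inj y-inj x≢y t | any? (λ i → x i ≟ t) | any? (λ j → y j ≟ t)
... | bound | _ | yes (j , refl) = pathBound-suc-hits y-inj j (λ i → x≢y i j) bound
... | bound | yes (i , refl) | no _ =
  pathBound-sym y x (suc t) (pathBound-suc-hits x-inj i (λ j → x≢y i j ∘ sym) (pathBound-sym x y t bound))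
... | bound | no t∉x | no t∉y = pathBound-suc-avoids (λ i e → t∉x (i , e)) (λ j e → t∉y (j , e)) bound

-- The least defect of a layout with a of the x's and b of the y's below z and a′ and b′ above.
twoPathCost : (a b a′ b′ : ℕ) → ℕ
twoPathCost a b a′ b′ = pathCost a b + pathCost a′ b′ + boundaryCost a b a′ b′

twoPathCost-reverse : ∀ a b a′ b′ → twoPathCost a b a′ b′ ≡ twoPathCost b′ a′ b a
twoPathCost-reverse a b a′ b′ rewrite pathCost-comm a b | pathCost-comm a′ b′ =
  regroup (pathCost b a) (pathCost b′ a′) (b * pairs a′) (b′ * pairs a) (a * pairs b′) (a′ * pairs b)
  where
  regroup : ∀ p q s t u v → p + q + (s + t + (u + v)) ≡ q + p + (v + u + (t + s))
  regroup = solve-∀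

twoPathCost-swap : ∀ a b a′ b′ → twoPathCost a b a′ b′ ≡ twoPathCost b a b′ a′
twoPathCost-swap a b a′ b′ = cong₂ _+_ (cong₂ _+_ (pathCost-comm a b) (pathCost-comm a′ b′))
  (+-comm (b * pairs a′ + b′ * pairs a) (a * pairs b′ + a′ * pairs b))

twoPathCost-suc : ∀ b u d → twoPathCost (suc b + d) (suc b) u (u + d)
  ≡ twoPathCost (b + d) b u (u + d) + pairs u + pairs (u + d) + 2 * ((b + u + d) * (b + d) + u * b)
twoPathCost-suc b u d = begin
  twoPathCost (suc b + d) (suc b) u (u + d)
    ≡⟨ cong₂ (λ v w → cost + 2 * (b * (b + d)) + cost′
                      + (suc b * pairs u + (u + d) * v + (suc (b + d) * pairs (u + d) + u * w)))
         (pairs-suc (b + d)) (pairs-suc b) ⟩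
  cost + 2 * (b * (b + d)) + cost′
    + (suc b * pairs u + (u + d) * (pairs (b + d) + 2 * (b + d))
      + (suc (b + d) * pairs (u + d) + u * (pairs b + 2 * b)))
    ≡⟨ collect b u d cost cost′ (pairs u) (pairs (b + d)) (pairs (u + d)) (pairs b) ⟩
  twoPathCost (b + d) b u (u + d) + pairs u + pairs (u + d) + 2 * ((b + u + d) * (b + d) + u * b) ∎
  where
  open ≡-Reasoning
  cost  = pathCost (b + d) b
  cost′ = pathCost u (u + d)
  collect : ∀ b u d c c′ pᵤ pᵇᵈ pᵘᵈ pᵇ →
    c + 2 * (b * (b + d)) + c′ + (suc b * pᵤ + (u + d) * (pᵇᵈ + 2 * (b + d)) + (suc (b + d) * pᵘᵈ + u * (pᵇ + 2 * b)))
    ≡ c + c′ + (b * pᵤ + (u + d) * pᵇᵈ + ((b + d) * pᵘᵈ + u * pᵇ)) + pᵤ + pᵘᵈ + 2 * ((b + u + d) * (b + d) + u * b)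
  collect = solve-∀

-- Deviating from the diagonal by d at z costs (b + u + 2 d) pairs d − 2∑squares d ≥ 0.
TwoPathFormula : (b u d : ℕ) → Set
TwoPathFormula b u d = twoPathCost (b + d) b u (u + d) + 2 * (b * u) + 2∑squares d
                       ≡ 2∑squares (b + u + d) + (b + u + 2 * d) * pairs d

twoPathFormula-zero : ∀ d → TwoPathFormula 0 0 d
twoPathFormula-zero d rewrite pathCost-comm 0 d = regroup d (pairs d) (2∑squares d)
  where
  regroup : ∀ d c s → d * c + (d * c + 0) + 0 + s ≡ s + 2 * d * c
  regroup = solve-∀

twoPathFormula-suc : ∀ b u d → TwoPathFormula b u d → TwoPathFormula (suc b) u d
twoPathFormula-suc b u d formula = +-cancelʳ-≡ (u + (u + d)) _ _ (begin
  twoPathCost (suc b + d) (suc b) u (u + d) + 2 * (suc b * u) + 2∑squares d + (u + (u + d))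
    ≡⟨ cong (λ c → c + 2 * (suc b * u) + 2∑squares d + (u + (u + d))) (twoPathCost-suc b u d) ⟩
  cost + pairs u + pairs (u + d) + 2 * (k * (b + d) + u * b) + 2 * (suc b * u) + 2∑squares d + (u + (u + d))
    ≡⟨ collect b u d cost (pairs u) (pairs (u + d)) (2∑squares d) ⟩
  cost + 2 * (b * u) + 2∑squares d + (pairs u + u) + (pairs (u + d) + (u + d)) + 2 * (k * (b + d) + u * b + u)
    ≡⟨ cong₂ (λ s t → s + t + 2 * (k * (b + d) + u * b + u))
         (cong₂ _+_ formula (pairs+n≡n*n u)) (pairs+n≡n*n (u + d)) ⟩
  2∑squares k + w * pairs d + u * u + (u + d) * (u + d) + 2 * (k * (b + d) + u * b + u)
    ≡⟨ completeSquare b u d (2∑squares k) (w * pairs d) ⟩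
  2∑squares (suc b + u + d) + w * pairs d + d * d + 2 * u
    ≡⟨ cong (λ s → 2∑squares (suc b + u + d) + w * pairs d + s + 2 * u) (pairs+n≡n*n d) ⟨
  2∑squares (suc b + u + d) + w * pairs d + (pairs d + d) + 2 * u
    ≡⟨ absorb u d (2∑squares (suc b + u + d)) w (pairs d) ⟩
  2∑squares (suc b + u + d) + suc w * pairs d + (u + (u + d)) ∎)
  where
  open ≡-Reasoning
  cost = twoPathCost (b + d) b u (u + d)
  k = b + u + d
  w = b + u + 2 * d
  collect : ∀ b u d c p q s →
    c + p + q + 2 * ((b + u + d) * (b + d) + u * b) + 2 * (suc b * u) + s + (u + (u + d))
    ≡ c + 2 * (b * u) + s + (p + u) + (q + (u + d)) + 2 * ((b + u + d) * (b + d) + u * b + u)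
  collect = solve-∀
  completeSquare : ∀ b u d s t →
    s + t + u * u + (u + d) * (u + d) + 2 * ((b + u + d) * (b + d) + u * b + u)
    ≡ 2 * ((b + u + d) * (b + u + d)) + s + t + d * d + 2 * u
  completeSquare = solve-∀
  absorb : ∀ u d s w p → s + w * p + (p + d) + 2 * u ≡ s + suc w * p + (u + (u + d))
  absorb = solve-∀

twoPathFormula-reverse : ∀ b u d → TwoPathFormula b u d → TwoPathFormula u b d
twoPathFormula-reverse b u d formula
  rewrite twoPathCost-reverse (u + d) u b (b + d) | +-comm u b | *-comm u b = formula

twoPathFormula : ∀ b u d → TwoPathFormula b u d
twoPathFormula (suc b) u       d = twoPathFormula-suc b u d (twoPathFormula b u d)
twoPathFormula zero    (suc u) d =
  twoPathFormula-reverse (suc u) 0 d (twoPathFormula-suc u 0 d (twoPathFormula-reverse 0 u d (twoPathFormula 0 u d)))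
twoPathFormula zero    zero    d = twoPathFormula-zero d

2∑squares≤2d*pairs : ∀ d → 2∑squares d ≤ 2 * d * pairs d
2∑squares≤2d*pairs zero    = z≤n
2∑squares≤2d*pairs (suc d) = begin
  2 * (d * d) + 2∑squares d                   ≤⟨ +-monoʳ-≤ (2 * (d * d)) (2∑squares≤2d*pairs d) ⟩
  2 * (d * d) + 2 * d * pairs d               ≤⟨ m≤m+n _ (2 * (pairs d + 2 * d) + 2 * (d * d)) ⟩
  2 * (d * d) + 2 * d * pairs d + (2 * (pairs d + 2 * d) + 2 * (d * d)) ≡⟨ regroup d (pairs d) ⟩
  2 * suc d * (pairs d + 2 * d)               ≡⟨ cong (2 * suc d *_) (pairs-suc d) ⟨
  2 * suc d * pairs (suc d)                   ∎
  where
  open ≤-Reasoning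
  regroup : ∀ d c → 2 * (d * d) + 2 * d * c + (2 * (c + 2 * d) + 2 * (d * d)) ≡ 2 * suc d * (c + 2 * d)
  regroup = solve-∀

2∑squares≤twoPathCost : ∀ b u d → 2∑squares (b + u + d) ≤ twoPathCost (b + d) b u (u + d) + 2 * (b * u)
2∑squares≤twoPathCost b u d = +-cancelʳ-≤ (2∑squares d) _ _ (begin
  2∑squares (b + u + d) + 2∑squares d
    ≤⟨ +-monoʳ-≤ (2∑squares (b + u + d))
         (≤-trans (2∑squares≤2d*pairs d) (*-monoˡ-≤ (pairs d) (m≤n+m (2 * d) (b + u)))) ⟩
  2∑squares (b + u + d) + (b + u + 2 * d) * pairs d
    ≡⟨ twoPathFormula b u d ⟨
  twoPathCost (b + d) b u (u + d) + 2 * (b * u) + 2∑squares d ∎)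
  where open ≤-Reasoning

halvesProduct : ℕ → ℕ
halvesProduct n = ⌊ n /2⌋ * ⌈ n /2⌉

m*n≤halvesProduct[m+n] : ∀ m n → m * n ≤ halvesProduct (m + n)
m*n≤halvesProduct[m+n] zero    n       = z≤n
m*n≤halvesProduct[m+n] (suc m) zero    rewrite *-zeroʳ m = z≤n
m*n≤halvesProduct[m+n] (suc m) (suc n) rewrite +-suc m n = begin
  suc m * suc n                                ≡⟨ expand m n ⟩
  suc (m + n) + m * n                          ≤⟨ +-monoʳ-≤ (suc (m + n)) (m*n≤halvesProduct[m+n] m n) ⟩
  suc (m + n) + halvesProduct (m + n)          ≡⟨ cong (λ k → suc k + halvesProduct (m + n)) (⌊n/2⌋+⌈n/2⌉≡n (m + n)) ⟨
  suc (⌊ m + n /2⌋ + ⌈ m + n /2⌉) + halvesProduct (m + n) ≡⟨ expand ⌊ m + n /2⌋ ⌈ m + n /2⌉ ⟨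
  suc ⌊ m + n /2⌋ * suc ⌈ m + n /2⌉            ∎
  where
  open ≤-Reasoning
  expand : ∀ m n → suc m * suc n ≡ suc (m + n) + m * n
  expand = solve-∀

halvesProduct-mono-≤ : ∀ {m n} → m ≤ n → halvesProduct m ≤ halvesProduct n
halvesProduct-mono-≤ m≤n = *-mono-≤ (⌊n/2⌋-mono m≤n) (⌈n/2⌉-mono m≤n)

TwoPathBound : (a b a′ b′ : ℕ) → Set
TwoPathBound a b a′ b′ = 2∑squares (a + a′) ≤ twoPathCost a b a′ b′ + 2 * halvesProduct (a + a′)

private
  twoPathBound-≥ : ∀ b d a′ b′ → b + d + a′ ≡ b + b′ → TwoPathBound (b + d) b a′ b′
  twoPathBound-≥ b d a′ b′ sum≡
    with refl ← +-cancelˡ-≡ b (a′ + d) b′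
                  (trans (cong (b +_) (+-comm a′ d)) (trans (sym (+-assoc b d a′)) sum≡)) = begin
    2∑squares (b + d + a′)
      ≡⟨ cong 2∑squares (swap b d a′) ⟩
    2∑squares (b + a′ + d)
      ≤⟨ 2∑squares≤twoPathCost b a′ d ⟩
    twoPathCost (b + d) b a′ (a′ + d) + 2 * (b * a′)
      ≤⟨ +-monoʳ-≤ (twoPathCost (b + d) b a′ (a′ + d)) (*-monoʳ-≤ 2 b*a′≤) ⟩
    twoPathCost (b + d) b a′ (a′ + d) + 2 * halvesProduct (b + d + a′) ∎
    where
    open ≤-Reasoning
    swap : ∀ b d a → b + d + a ≡ b + a + d
    swap = solve-∀
    b*a′≤ : b * a′ ≤ halvesProduct (b + d + a′)
    b*a′≤ = ≤-trans (m*n≤halvesProduct[m+n] b a′) (halvesProduct-mono-≤ (+-monoˡ-≤ a′ (m≤m+n b d)))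

twoPathBound : ∀ a b a′ b′ → a + a′ ≡ b + b′ → TwoPathBound a b a′ b′
twoPathBound a b a′ b′ sum≡ with ≤-total b a
... | inj₁ b≤a with d , refl ← m≤n⇒∃[o]m+o≡n b≤a = twoPathBound-≥ b d a′ b′ sum≡
... | inj₂ a≤b with d , refl ← m≤n⇒∃[o]m+o≡n a≤b
  rewrite twoPathCost-swap a (a + d) a′ b′ | sum≡ = twoPathBound-≥ a d b′ a′ (sym sum≡)

module _ (ℓ : Layout m) where
  open Layout ℓ
  private module ℓʳ = Layout (reverse ℓ)

  2∑squares≤defect : 2∑squares m ≤ defect ℓ + 2 * halvesProduct m
  2∑squares≤defect = begin
    2∑squares m
      ≡⟨ cong 2∑squares (below+above x≢z) ⟨
    2∑squares (below x z + above x z)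
      ≤⟨ twoPathBound (below x z) (below y z) (above x z) (above y z)
           (trans (below+above x≢z) (sym (below+above y≢z))) ⟩
    twoPathCost (below x z) (below y z) (above x z) (above y z) + 2 * halvesProduct (below x z + above x z)
      ≡⟨ cong (λ k → twoPathCost (below x z) (below y z) (above x z) (above y z) + 2 * halvesProduct k)
           (below+above x≢z) ⟩
    twoPathCost (below x z) (below y z) (above x z) (above y z) + 2 * halvesProduct m
      ≤⟨ +-monoˡ-≤ (2 * halvesProduct m) (+-monoˡ-≤ (boundaryCost (below x z) (below y z) (above x z) (above y z))
           (+-mono-≤ (pathCost≤walkCost x-injective y-injective x≢y z) pathCost≤walkCost-reverse)) ⟩
    defect ℓ + 2 * halvesProduct m ∎
    where
    open ≤-Reasoning
    pathCost≤walkCost-reverse : pathCost (above x z) (above y z) ≤ walkCost ℓʳ.x ℓʳ.y ℓʳ.z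
    pathCost≤walkCost-reverse = subst (_≤ walkCost ℓʳ.x ℓʳ.y ℓʳ.z)
      (cong₂ pathCost (below-reverse ℓ x≤bound z≤bound) (below-reverse ℓ y≤bound z≤bound))
      (pathCost≤walkCost ℓʳ.x-injective ℓʳ.y-injective ℓʳ.x≢y ℓʳ.z)

  hubCrossings-upperBound : 2 * hubCrossings ℓ + 2∑squares m ≤ 2 * (m * pairs m) + 2 * halvesProduct m
  hubCrossings-upperBound = begin
    2 * hubCrossings ℓ + 2∑squares m
      ≤⟨ +-monoʳ-≤ (2 * hubCrossings ℓ) 2∑squares≤defect ⟩
    2 * hubCrossings ℓ + (defect ℓ + 2 * halvesProduct m)
      ≡⟨ +-assoc (2 * hubCrossings ℓ) (defect ℓ) _ ⟨
    2 * hubCrossings ℓ + defect ℓ + 2 * halvesProduct m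
      ≡⟨ cong (_+ 2 * halvesProduct m) (hubCrossings+defect ℓ) ⟩
    2 * (m * pairs m) + 2 * halvesProduct m ∎
    where open ≤-Reasoning

-- The alternating layout

slot : ℕ → ℕ → ℕ
slot r i = r + i * 3

private
  1<3 : 1 < 3
  1<3 = s<s z<s

  2<3 : 2 < 3
  2<3 = s<s (s<s z<s)

slot-mono-< : ∀ {r i j} s → r < 3 → i < j → slot r i < slot s j
slot-mono-< s r<3 i<j = ≤-trans (+-mono-<-≤ r<3 ≤-refl) (≤-trans (*-monoˡ-≤ 3 i<j) (m≤n+m _ s))

slot-<ᵇ-< : ∀ {r s} → r < s → s < 3 → ∀ i j → (slot r i <ᵇ slot s j) ≡ (i <ᵇ suc j)
slot-<ᵇ-< {r} r<s s<3 i j = sym (<ᵇ-cong {i} {suc j}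
  (λ i<1+j → +-mono-<-≤ r<s (*-monoˡ-≤ 3 (≤-pred i<1+j)))
  (<⇒≤ ∘ slot-mono-< r s<3))

slot-<ᵇ-≥ : ∀ {r s} → s ≤ r → r < 3 → ∀ i j → (slot r i <ᵇ slot s j) ≡ (i <ᵇ j)
slot-<ᵇ-≥ {s = s} s≤r r<3 i j = sym (<ᵇ-cong {i} {j}
  (slot-mono-< s r<3)
  (λ j≤i → +-mono-≤ s≤r (*-monoˡ-≤ 3 j≤i)))

slot-injective : ∀ r {i j} → slot r i ≡ slot r j → i ≡ j
slot-injective r {i} {j} = *-cancelʳ-≡ i j 3 ∘ +-cancelˡ-≡ r _ _

slot-≢ : ∀ r s → r % 3 ≢ s % 3 → ∀ i j → slot r i ≢ slot s j
slot-≢ r s r≢s i j e = r≢s (begin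
  r % 3            ≡⟨ [m+kn]%n≡m%n r i 3 ⟨
  slot r i % 3     ≡⟨ cong (_% 3) e ⟩
  slot s j % 3     ≡⟨ [m+kn]%n≡m%n s j 3 ⟩
  s % 3            ∎)
  where open ≡-Reasoning

-- The order is x₀ y₀ x₁ y₁ … with z after the first h pairs; each pair occupies two of three
-- consecutive positions, which leaves room for z.
alternating : ∀ {h} → h ≤ m → Layout m
alternating {m} {h} h≤m = record
  { z = slot 0 h ; x = slot 1 ∘ toℕ ; y = slot 2 ∘ toℕ
  ; x-injective = toℕ-injective ∘ slot-injective 1 ; y-injective = toℕ-injective ∘ slot-injective 2
  ; x≢y = λ i j → slot-≢ 1 2 (λ ()) (toℕ i) (toℕ j)
  ; x≢z = λ i → slot-≢ 1 0 (λ ()) (toℕ i) h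
  ; y≢z = λ i → slot-≢ 2 0 (λ ()) (toℕ i) h
  ; bound = slot 0 m
  ; x≤bound = λ i → <⇒≤ (slot-mono-< 0 1<3 (toℕ<n i))
  ; y≤bound = λ i → <⇒≤ (slot-mono-< 0 2<3 (toℕ<n i))
  ; z≤bound = *-monoˡ-≤ 3 h≤m }

pathCost-diagonal : ∀ n → pathCost n n ≡ 2∑squares n
pathCost-diagonal zero    = refl
pathCost-diagonal (suc n) = trans (cong (_+ 2 * (n * n)) (pathCost-diagonal n)) (+-comm (2∑squares n) (2 * (n * n)))

twoPathCost-diagonal : ∀ h k → twoPathCost h h k k + 2 * (h * k) ≡ 2∑squares (h + k)
twoPathCost-diagonal h k with formula ← twoPathFormula h k 0
  rewrite +-identityʳ h | +-identityʳ k | +-identityʳ (h + k) | *-zeroʳ (h + k)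
        | +-identityʳ (twoPathCost h h k k + 2 * (h * k)) | +-identityʳ (2∑squares (h + k)) = formula

module Alternating {m h : ℕ} (h≤m : h ≤ m) where
  open Layout (alternating h≤m)
  private
    ℓ = alternating h≤m
    module ℓʳ = Layout (reverse ℓ)

  x<ᵇy : ∀ i j → (x i <ᵇ y j) ≡ (toℕ i <ᵇ suc (toℕ j))
  x<ᵇy i j = slot-<ᵇ-< ≤-refl 2<3 (toℕ i) (toℕ j)

  y<ᵇx : ∀ j i → (y j <ᵇ x i) ≡ (toℕ j <ᵇ toℕ i)
  y<ᵇx j i = slot-<ᵇ-≥ (s≤s z≤n) 2<3 (toℕ j) (toℕ i)

  x<ᵇx : ∀ i j → (x i <ᵇ x j) ≡ (toℕ i <ᵇ toℕ j)
  x<ᵇx i j = slot-<ᵇ-≥ ≤-refl 1<3 (toℕ i) (toℕ j)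

  x<ᵇz : ∀ i → (x i <ᵇ z) ≡ (toℕ i <ᵇ h)
  x<ᵇz i = slot-<ᵇ-≥ z≤n 1<3 (toℕ i) h

  y<ᵇz : ∀ j → (y j <ᵇ z) ≡ (toℕ j <ᵇ h)
  y<ᵇz j = slot-<ᵇ-≥ z≤n 2<3 (toℕ j) h

  z<ᵇx : ∀ i → (z <ᵇ x i) ≡ (h <ᵇ suc (toℕ i))
  z<ᵇx i = slot-<ᵇ-< ≤-refl 1<3 h (toℕ i)

  z<ᵇy : ∀ j → (z <ᵇ y j) ≡ (h <ᵇ suc (toℕ j))
  z<ᵇy j = slot-<ᵇ-< (s≤s z≤n) 2<3 h (toℕ j)

  below-x-y : ∀ j → below x (y j) ≡ suc (toℕ j)
  below-x-y j = trans (sum-cong-≗ λ i → cong [_] (x<ᵇy i j)) (count-< (toℕ<n j))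

  below-y-x : ∀ i → below y (x i) ≡ toℕ i
  below-y-x i = trans (sum-cong-≗ λ j → cong [_] (y<ᵇx j i)) (count-< (<⇒≤ (toℕ<n i)))

  above-x-y : ∀ j → above x (y j) ≡ m ∸ suc (toℕ j)
  above-x-y j = trans (sum-cong-≗ λ i → cong [_] (y<ᵇx j i)) (count-≥ m (suc (toℕ j)))

  above-y-x : ∀ i → above y (x i) ≡ suc (m ∸ suc (toℕ i))
  above-y-x i = trans (sum-cong-≗ λ j → cong [_] (x<ᵇy i j)) (trans (count-≥ m (toℕ i)) (+-∸-assoc 1 (toℕ<n i)))

  below-x-z : below x z ≡ h
  below-x-z = trans (sum-cong-≗ (cong [_] ∘ x<ᵇz)) (count-< h≤m)

  below-y-z : below y z ≡ h
  below-y-z = trans (sum-cong-≗ (cong [_] ∘ y<ᵇz)) (count-< h≤m)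

  above-x-z : above x z ≡ m ∸ h
  above-x-z = trans (sum-cong-≗ (cong [_] ∘ z<ᵇx)) (count-≥ m h)

  above-y-z : above y z ≡ m ∸ h
  above-y-z = trans (sum-cong-≗ (cong [_] ∘ z<ᵇy)) (count-≥ m h)

  walkCost-alternating : walkCost x y z ≡ 2∑squares h
  walkCost-alternating = trans
    (cong₂ _+_
      (trans (sum-cong-≗ λ j → cong₂ (λ b k → [ b ] * pairs k) (y<ᵇz j) (below-x-y j)) (∑-prefix (pairs ∘ suc) h≤m))
      (trans (sum-cong-≗ λ i → cong₂ (λ b k → [ b ] * pairs k) (x<ᵇz i) (below-y-x i)) (∑-prefix pairs h≤m)))
    (prefixSum-pairs h)

  walkCost-reverse-alternating : walkCost ℓʳ.x ℓʳ.y ℓʳ.z ≡ 2∑squares (m ∸ h)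
  walkCost-reverse-alternating = trans
    (cong₂ _+_
      (trans (pairsUnder-reverse ℓ) (trans
        (sum-cong-≗ λ j → cong₂ (λ b k → [ b ] * pairs k) (z<ᵇy j) (above-x-y j)) (∑-suffix pairs m h)))
      (trans (pairsUnder-reverse (swapParts ℓ)) (trans
        (sum-cong-≗ λ i → cong₂ (λ b k → [ b ] * pairs k) (z<ᵇx i) (above-y-x i)) (∑-suffix (pairs ∘ suc) m h))))
    (trans (+-comm (prefixSum pairs (m ∸ h)) _) (prefixSum-pairs (m ∸ h)))

  defect-alternating : defect ℓ ≡ twoPathCost h h (m ∸ h) (m ∸ h)
  defect-alternating = cong₂ _+_
    (cong₂ _+_ (trans walkCost-alternating (sym (pathCost-diagonal h)))
               (trans walkCost-reverse-alternating (sym (pathCost-diagonal (m ∸ h)))))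
    (trans (cong₂ (λ a b → boundaryCost a b (above x z) (above y z)) below-x-z below-y-z)
           (cong₂ (boundaryCost h h) above-x-z above-y-z))

  hubCrossings-alternating : 2 * hubCrossings ℓ + 2∑squares m ≡ 2 * (m * pairs m) + 2 * (h * (m ∸ h))
  hubCrossings-alternating = begin
    2 * hubCrossings ℓ + 2∑squares m
      ≡⟨ cong (λ k → 2 * hubCrossings ℓ + 2∑squares k) (m+[n∸m]≡n h≤m) ⟨
    2 * hubCrossings ℓ + 2∑squares (h + (m ∸ h))
      ≡⟨ cong (2 * hubCrossings ℓ +_) (twoPathCost-diagonal h (m ∸ h)) ⟨
    2 * hubCrossings ℓ + (twoPathCost h h (m ∸ h) (m ∸ h) + 2 * (h * (m ∸ h)))
      ≡⟨ cong (λ c → 2 * hubCrossings ℓ + (c + 2 * (h * (m ∸ h)))) defect-alternating ⟨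
    2 * hubCrossings ℓ + (defect ℓ + 2 * (h * (m ∸ h)))
      ≡⟨ +-assoc (2 * hubCrossings ℓ) (defect ℓ) _ ⟨
    2 * hubCrossings ℓ + defect ℓ + 2 * (h * (m ∸ h))
      ≡⟨ cong (_+ 2 * (h * (m ∸ h))) (hubCrossings+defect ℓ) ⟩
    2 * (m * pairs m) + 2 * (h * (m ∸ h)) ∎
    where open ≡-Reasoning

  ∑≠-outside-alternating : ∑≠ (λ i j → outside (x i) (x j) y) ≡ prefixSum 2∑squares m
  ∑≠-outside-alternating = begin
    ∑≠ outer
      ≡⟨ trans (cong (∑≠ outer +_) (∑-zero λ i → outside-≥ y (≤-refl {x i}))) (+-identityʳ (∑≠ outer)) ⟨
    ∑≠ outer + ∑[ i < m ] outer i i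
      ≡⟨ ∑≠-diagonal outer ⟩
    ∑[ i < m ] ∑[ j < m ] outer i j
      ≡⟨ sum-cong-≗ (λ i → sum-cong-≗ (outer-split i)) ⟩
    ∑[ i < m ] ∑[ j < m ] (lower i j + upper i j)
      ≡⟨ ∑∑-distrib-+ lower upper ⟩
    ∑[ i < m ] ∑[ j < m ] lower i j + ∑[ i < m ] ∑[ j < m ] upper i j
      ≡⟨ cong₂ _+_ ∑∑-lower ∑∑-upper ⟩
    prefixSum (prefixSum pairs) m + prefixSum (prefixSum (pairs ∘ suc)) m
      ≡⟨ trans (+-comm (prefixSum (prefixSum pairs) m) _)
               (sym (prefixSum-+ (prefixSum (pairs ∘ suc)) (prefixSum pairs) m)) ⟩
    prefixSum (λ i → prefixSum (pairs ∘ suc) i + prefixSum pairs i) m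
      ≡⟨ prefixSum-cong prefixSum-pairs m ⟩
    prefixSum 2∑squares m ∎
    where
    open ≡-Reasoning
    outer lower upper : Fin m → Fin m → ℕ
    outer i j = outside (x i) (x j) y
    lower i j = [ toℕ i <ᵇ toℕ j ] * pairs (toℕ i)
    upper i j = [ toℕ i <ᵇ toℕ j ] * pairs (suc (m ∸ suc (toℕ j)))
    ∑∑-lower : ∑[ i < m ] ∑[ j < m ] lower i j ≡ prefixSum (prefixSum pairs) m
    ∑∑-lower = begin
      ∑[ i < m ] ∑[ j < m ] lower i j                  ≡⟨ ∑-comm lower ⟩
      ∑[ j < m ] ∑[ i < m ] lower i j                  ≡⟨ sum-cong-≗ {m} (λ j → ∑-prefix pairs (<⇒≤ (toℕ<n j))) ⟩
      ∑[ j < m ] prefixSum pairs (toℕ j)           ≡⟨ ∑-toℕ (prefixSum pairs) m ⟩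
      prefixSum (prefixSum pairs) m                ∎
    ∑∑-upper : ∑[ i < m ] ∑[ j < m ] upper i j ≡ prefixSum (prefixSum (pairs ∘ suc)) m
    ∑∑-upper = begin
      ∑[ i < m ] ∑[ j < m ] upper i j
        ≡⟨ sum-cong-≗ {m} (λ i → ∑-suffix (pairs ∘ suc) m (suc (toℕ i))) ⟩
      ∑[ i < m ] prefixSum (pairs ∘ suc) (m ∸ suc (toℕ i))
        ≡⟨ ∑-opposite (prefixSum (pairs ∘ suc)) m ⟩
      prefixSum (prefixSum (pairs ∘ suc)) m ∎
    outer-split : ∀ i j → outer i j ≡ lower i j + upper i j
    outer-split i j = trans
      (cong₂ (λ b k → [ b ] * k) (x<ᵇx i j) (cong₂ (λ k l → pairs k + pairs l) (below-y-x i) (above-y-x j)))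
      (*-distribˡ-+ [ toℕ i <ᵇ toℕ j ] (pairs (toℕ i)) (pairs (suc (m ∸ suc (toℕ j)))))

-- Vertices, edges and orderings

injective⇒surjective : {f : Fin n → Fin n} → Injective _≡_ _≡_ f → ∀ k → ∃[ i ] f i ≡ k
injective⇒surjective {suc n} {f} f-inj k with any? (λ i → f i ≟ᶠ k)
... | yes found  = found
... | no  missed = contradiction (injective⇒≤ avoid-injective) 1+n≰n
  where
  k≢f : ∀ i → k ≢ f i
  k≢f i k≡fi = missed (i , sym k≡fi)
  avoid : Fin (suc n) → Fin n
  avoid i = punchOut (k≢f i)
  avoid-injective : Injective _≡_ _≡_ avoid
  avoid-injective {i} {j} = f-inj ∘ punchOut-injective (k≢f i) (k≢f j)

injective⇒permutation : {f : Fin n → Fin n} → Injective _≡_ _≡_ f → Permutation′ n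
injective⇒permutation {f = f} f-inj =
  permutation f (proj₁ ∘ preimage) (proj₂ ∘ preimage) (f-inj ∘ proj₂ ∘ preimage ∘ f)
  where preimage = injective⇒surjective f-inj

below-mono-≤ : (p : Fin n → ℕ) → ∀ {s t} → s ≤ t → below p s ≤ below p t
below-mono-≤ p {s} {t} s≤t = ∑-mono-≤ λ i → indicator-mono (p i)
  where
  indicator-mono : ∀ a → [ a <ᵇ s ] ≤ [ a <ᵇ t ]
  indicator-mono a with a <? s
  ... | yes a<s rewrite <ᵇ-true a<s | <ᵇ-true (≤-trans a<s s≤t) = ≤-refl
  ... | no  a≮s rewrite <ᵇ-false (≮⇒≥ a≮s) = z≤n

below≤n : (p : Fin n → ℕ) → ∀ t → below p t ≤ n
below≤n {n} p t = ≤-trans (∑-mono-≤ λ i → [b]≤1 (p i <ᵇ t)) (≤-reflexive (trans (∑-const n 1) (*-identityʳ n)))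
  where
  [b]≤1 : ∀ b → [ b ] ≤ 1
  [b]≤1 false = z≤n
  [b]≤1 true  = ≤-refl

module _ {key : Fin n → ℕ} (key-inj : Injective _≡_ _≡_ key) where

  rank : Fin n → ℕ
  rank v = below key (key v)

  rank<n : ∀ v → rank v < n
  rank<n v = subst (_≤ n) (below-suc-hits key-inj v) (below≤n key (suc (key v)))

  rank-mono-< : ∀ {u v} → key u < key v → rank u < rank v
  rank-mono-< {u} {v} u<v = subst (_≤ rank v) (below-suc-hits key-inj u) (below-mono-≤ key u<v)

  rank-<ᵇ : ∀ u v → (rank u <ᵇ rank v) ≡ (key u <ᵇ key v)
  rank-<ᵇ u v = sym (<ᵇ-cong {key u} {key v} rank-mono-< (below-mono-≤ key))

  rank-injective : Injective _≡_ _≡_ rank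
  rank-injective {u} {v} rank≡ with <-cmp (key u) (key v)
  ... | tri< u<v _ _ = contradiction rank≡ (<⇒≢ (rank-mono-< u<v))
  ... | tri≈ _ u≡v _ = key-inj u≡v
  ... | tri> _ _ v<u = contradiction (sym rank≡) (<⇒≢ (rank-mono-< v<u))

  orderBy : LinOrd n
  orderBy = injective⇒permutation {f = λ v → fromℕ< (rank<n v)}
    λ {u} {v} → rank-injective ∘ fromℕ<-injective (rank u) (rank v) (rank<n u) (rank<n v)

  pos-orderBy-<ᵇ : ∀ u v → (pos orderBy u <ᵇ pos orderBy v) ≡ (key u <ᵇ key v)
  pos-orderBy-<ᵇ u v = trans (cong₂ _<ᵇ_ (toℕ-fromℕ< (rank<n u)) (toℕ-fromℕ< (rank<n v))) (rank-<ᵇ u v)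

  separates-orderBy : ∀ a b c d → separates orderBy a b c d ≡ sep (key a) (key b) (key c) (key d)
  separates-orderBy a b c d = cong₂ _∨_ (precedes-orderBy a b c d) (precedes-orderBy c d a b)
    where
    precedes-orderBy : ∀ a b c d → precedes orderBy a b c d ≡ before (key a) (key b) (key c) (key d)
    precedes-orderBy a b c d = cong₂ _∧_ (pos-orderBy-<ᵇ a c) (cong₂ _∧_ (pos-orderBy-<ᵇ a d)
                              (cong₂ _∧_ (pos-orderBy-<ᵇ b c) (pos-orderBy-<ᵇ b d)))

xv yv : Fin m → Fin (1 + m + m)
xv {m} i = suc (i ↑ˡ m)
yv {m} j = suc (m ↑ʳ j)

data Vertex (m : ℕ) : Fin (1 + m + m) → Set where
  is-z : Vertex m zero
  is-x : (i : Fin m) → Vertex m (xv i)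
  is-y : (j : Fin m) → Vertex m (yv j)

vertex : ∀ m v → Vertex m v
vertex m zero    = is-z
vertex m (suc w) with splitAt m w | join-splitAt m m w
... | inj₁ i | refl = is-x i
... | inj₂ j | refl = is-y j

part-x : (i : Fin m) → part m (xv i) ≡ 1
part-x {m} i rewrite toℕ-↑ˡ i m | <ᵇ-true (toℕ<n i) = refl

part-y : (j : Fin m) → part m (yv j) ≡ 2
part-y {m} j rewrite toℕ-↑ʳ m j | <ᵇ-false (m≤m+n m (toℕ j)) = refl

data Edge (m : ℕ) : (a b : Fin (1 + m + m)) → Set where
  zx : (i : Fin m)   → Edge m zero (xv i)
  zy : (j : Fin m)   → Edge m zero (yv j)
  xy : (i j : Fin m) → Edge m (xv i) (yv j)

edge⇒adj : ∀ {a b} → Edge m a b → Adj m a b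
edge⇒adj (zx i)   e = contradiction (trans e (part-x i)) λ ()
edge⇒adj (zy j)   e = contradiction (trans e (part-y j)) λ ()
edge⇒adj (xy i j) e = contradiction (trans (sym (part-x i)) (trans e (part-y j))) λ ()

adj⇒edge : ∀ m a b → Adj m a b → Edge m a b ⊎ Edge m b a
adj⇒edge m a b adj with vertex m a | vertex m b
... | is-z   | is-z   = contradiction refl adj
... | is-z   | is-x i = inj₁ (zx i)
... | is-z   | is-y j = inj₁ (zy j)
... | is-x i | is-z   = inj₂ (zx i)
... | is-x i | is-x k = contradiction (trans (part-x i) (sym (part-x k))) adj
... | is-x i | is-y j = inj₁ (xy i j)
... | is-y j | is-z   = inj₂ (zy j)
... | is-y j | is-x i = inj₂ (xy i j)
... | is-y j | is-y l = contradiction (trans (part-y j) (sym (part-y l))) adj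

xv-injective : Injective _≡_ _≡_ (xv {m})
xv-injective {m} {i} {j} = ↑ˡ-injective m i j ∘ suc-injectiveᶠ

yv-injective : Injective _≡_ _≡_ (yv {m})
yv-injective {m} {i} {j} = ↑ʳ-injective m i j ∘ suc-injectiveᶠ

xv≢yv : (i j : Fin m) → xv i ≢ yv j
xv≢yv {m} i j = edge⇒adj (xy i j) ∘ cong (part m)

pos-injective : (σ : LinOrd n) → Injective _≡_ _≡_ (pos σ)
pos-injective σ = Injection.injective (↔⇒↣ σ) ∘ toℕ-injective

layoutOf : LinOrd (1 + m + m) → Layout m
layoutOf {m} σ = record
  { z = pos σ zero ; x = pos σ ∘ xv ; y = pos σ ∘ yv
  ; x-injective = xv-injective ∘ pos-injective σ ; y-injective = yv-injective ∘ pos-injective σ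
  ; x≢y = λ i j → xv≢yv i j ∘ pos-injective σ
  ; x≢z = λ i e → contradiction (pos-injective σ e) λ ()
  ; y≢z = λ j e → contradiction (pos-injective σ e) λ ()
  ; bound = m + m ; x≤bound = pos≤ ∘ xv ; y≤bound = pos≤ ∘ yv ; z≤bound = pos≤ zero }
  where
  pos≤ : ∀ v → pos σ v ≤ m + m
  pos≤ v = ≤-pred (toℕ<n (σ ⟨$⟩ʳ v))

module _ (ℓ : Layout m) where
  private module ℓ = Layout ℓ

  position : Fin (1 + m + m) → ℕ
  position zero    = ℓ.z
  position (suc w) = [ ℓ.x , ℓ.y ]′ (splitAt m w)

  position-x : ∀ i → position (xv i) ≡ ℓ.x i
  position-x i = cong [ ℓ.x , ℓ.y ]′ (splitAt-↑ˡ m i m)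

  position-y : ∀ j → position (yv j) ≡ ℓ.y j
  position-y j = cong [ ℓ.x , ℓ.y ]′ (splitAt-↑ʳ m m j)

  position-injective : Injective _≡_ _≡_ position
  position-injective {u} {v} e with vertex m u | vertex m v
  ... | is-z   | is-z   = refl
  ... | is-z   | is-x i = contradiction (trans (sym (position-x i)) (sym e)) (ℓ.x≢z i)
  ... | is-z   | is-y j = contradiction (trans (sym (position-y j)) (sym e)) (ℓ.y≢z j)
  ... | is-x i | is-z   = contradiction (trans (sym (position-x i)) e) (ℓ.x≢z i)
  ... | is-y j | is-z   = contradiction (trans (sym (position-y j)) e) (ℓ.y≢z j)
  ... | is-x i | is-x k = cong xv (ℓ.x-injective (trans (sym (position-x i)) (trans e (position-x k))))
  ... | is-y j | is-y l = cong yv (ℓ.y-injective (trans (sym (position-y j)) (trans e (position-y l))))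
  ... | is-x i | is-y j = contradiction (trans (sym (position-x i)) (trans e (position-y j))) (ℓ.x≢y i j)
  ... | is-y j | is-x i = contradiction (trans (sym (position-x i)) (trans (sym e) (position-y j))) (ℓ.x≢y i j)

  orderOf : LinOrd (1 + m + m)
  orderOf = orderBy position-injective

-- Counting separations in a list of orderings

countSep-tabulate : ∀ {k} (F : Fin k → LinOrd n) a b c d →
                    countSep (tabulate F) a b c d ≡ ∑[ s < k ] [ separates (F s) a b c d ]
countSep-tabulate {k = zero}  F a b c d = refl
countSep-tabulate {k = suc k} F a b c d =
  cong ([ separates (F zero) a b c d ] +_) (countSep-tabulate (F ∘ suc) a b c d)

countSep-lookup : ∀ (L : List (LinOrd n)) a b c d →
                  countSep L a b c d ≡ ∑[ s < length L ] [ separates (lookup L s) a b c d ]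
countSep-lookup L a b c d = trans (cong (λ M → countSep M a b c d) (sym (tabulate-lookup L)))
                                  (countSep-tabulate (lookup L) a b c d)

countSep-++ : ∀ (L M : List (LinOrd n)) a b c d →
              countSep (L ++ M) a b c d ≡ countSep L a b c d + countSep M a b c d
countSep-++ []      M a b c d = refl
countSep-++ (σ ∷ L) M a b c d = trans (cong ([ separates σ a b c d ] +_) (countSep-++ L M a b c d))
                                      (sym (+-assoc [ separates σ a b c d ] _ _))

countSep-cong : ∀ (L : List (LinOrd n)) {a b c d a′ b′ c′ d′} →
  (∀ σ → separates σ a b c d ≡ separates σ a′ b′ c′ d′) → countSep L a b c d ≡ countSep L a′ b′ c′ d′
countSep-cong []      sep≡ = refl
countSep-cong (σ ∷ L) sep≡ = cong₂ _+_ (cong [_] (sep≡ σ)) (countSep-cong L sep≡)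

countSep-flipˡ : ∀ (L : List (LinOrd n)) a b c d → countSep L a b c d ≡ countSep L b a c d
countSep-flipˡ L a b c d = countSep-cong L λ σ → sep-flipˡ (pos σ a) (pos σ b) (pos σ c) (pos σ d)

countSep-flipʳ : ∀ (L : List (LinOrd n)) a b c d → countSep L a b c d ≡ countSep L a b d c
countSep-flipʳ L a b c d = countSep-cong L λ σ → sep-flipʳ (pos σ a) (pos σ b) (pos σ c) (pos σ d)

countSep-swap : ∀ (L : List (LinOrd n)) a b c d → countSep L a b c d ≡ countSep L c d a b
countSep-swap L a b c d = countSep-cong L λ σ → sep-swap (pos σ a) (pos σ b) (pos σ c) (pos σ d)

module _ {t} (L : List (LinOrd (1 + m + m)))
  (x-spokes : ∀ {i j k : Fin m} → i ≢ k → t ≤ countSep L zero (xv i) (yv j) (xv k))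
  (y-spokes : ∀ {i j k : Fin m} → i ≢ k → t ≤ countSep L zero (yv i) (xv j) (yv k))
  (rim      : ∀ {i j k l : Fin m} → i ≢ j → k ≢ l → t ≤ countSep L (xv i) (yv k) (xv j) (yv l)) where

  private
    Disjoint : (a b c d : Fin (1 + m + m)) → Set
    Disjoint a b c d = (a ≢ c) × (a ≢ d) × (b ≢ c) × (b ≢ d)

    flipˡ : ∀ a b c d → t ≤ countSep L a b c d → t ≤ countSep L b a c d
    flipˡ a b c d = subst (t ≤_) (countSep-flipˡ L a b c d)

    flipʳ : ∀ a b c d → t ≤ countSep L a b c d → t ≤ countSep L a b d c
    flipʳ a b c d = subst (t ≤_) (countSep-flipʳ L a b c d)

    swap : ∀ a b c d → t ≤ countSep L a b c d → t ≤ countSep L c d a b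
    swap a b c d = subst (t ≤_) (countSep-swap L a b c d)

    zx-xy : ∀ {i j k : Fin m} → i ≢ k → t ≤ countSep L zero (xv i) (xv k) (yv j)
    zx-xy {i} {j} {k} i≢k = flipʳ zero (xv i) (yv j) (xv k) (x-spokes i≢k)

    edges-separated : ∀ {a b c d} → Edge m a b → Edge m c d → Disjoint a b c d → t ≤ countSep L a b c d
    edges-separated (zx i)   (zx k)   (z≢z , _)         = contradiction refl z≢z
    edges-separated (zx i)   (zy j)   (z≢z , _)         = contradiction refl z≢z
    edges-separated (zy j)   (zx i)   (z≢z , _)         = contradiction refl z≢z
    edges-separated (zy j)   (zy l)   (z≢z , _)         = contradiction refl z≢z
    edges-separated (zx i)   (xy k j) (_ , _ , i≢k , _) = zx-xy (i≢k ∘ cong xv)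
    edges-separated (zy j)   (xy i l) (_ , _ , _ , j≢l) = y-spokes (j≢l ∘ cong yv)
    edges-separated (xy i j) (zx k)   (_ , i≢k , _)     =
      swap zero (xv k) (xv i) (yv j) (zx-xy (i≢k ∘ cong xv ∘ sym))
    edges-separated (xy i j) (zy l)   (_ , _ , _ , j≢l) =
      swap zero (yv l) (xv i) (yv j) (y-spokes (j≢l ∘ cong yv ∘ sym))
    edges-separated (xy i j) (xy k l) (i≢k , _ , _ , j≢l) = rim (i≢k ∘ cong xv) (j≢l ∘ cong yv)

  tSeparating-intro : TSeparating m t L
  tSeparating-intro a b c d (ab , cd , ac , ad , bc , bd) with adj⇒edge m a b ab | adj⇒edge m c d cd
  ... | inj₁ ab | inj₁ cd = edges-separated ab cd (ac , ad , bc , bd)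
  ... | inj₁ ab | inj₂ dc = flipʳ a b d c (edges-separated ab dc (ad , ac , bd , bc))
  ... | inj₂ ba | inj₁ cd = flipˡ b a c d (edges-separated ba cd (bc , bd , ac , ad))
  ... | inj₂ ba | inj₂ dc = flipʳ a b d c (flipˡ b a d c (edges-separated ba dc (bd , bc , ad , ac)))

separated-spokes-≤ : ∀ {t} (L : List (LinOrd n)) (v : Fin n) (p q : Fin m → Fin n) →
  (∀ {i k} j → i ≢ k → t ≤ countSep L v (p i) (q j) (p k)) →
  m * (pairs m * t) ≤ ∑[ s < length L ] ∑[ j < m ]
    (let π = pos (lookup L s) in crossings (π v) (π (q j)) (π ∘ p))
separated-spokes-≤ {m = m} {t} L v p q separated = begin
  m * (pairs m * t)
    ≡⟨ ∑-const m (pairs m * t) ⟨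
  ∑[ j < m ] (pairs m * t)
    ≡⟨ sum-cong-≗ {m} (λ j → ∑≠-const m t) ⟨
  ∑[ j < m ] ∑≠ {m} (λ i k → t)
    ≤⟨ ∑-mono-≤ {m} (λ j → ∑≠-mono-≤ (separated j)) ⟩
  ∑[ j < m ] ∑≠ (λ i k → countSep L v (p i) (q j) (p k))
    ≡⟨ sum-cong-≗ {m} (λ j → ∑≠-cong λ {i} {k} _ → countSep-lookup L v (p i) (q j) (p k)) ⟩
  ∑[ j < m ] ∑≠ (λ i k → ∑[ s < length L ] cross s j i k)
    ≡⟨ sum-cong-≗ {m} (λ j → ∑-∑≠-comm λ s → cross s j) ⟨
  ∑[ j < m ] ∑[ s < length L ] ∑≠ (cross s j)
    ≡⟨ ∑-comm (λ j s → ∑≠ (cross s j)) ⟩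
  ∑[ s < length L ] ∑[ j < m ] ∑≠ (cross s j) ∎
  where
  open ≤-Reasoning
  cross : Fin (length L) → Fin m → Fin m → Fin m → ℕ
  cross s j i k = [ separates (lookup L s) v (p i) (q j) (p k) ]

separating⇒length-≥ : ∀ {t c} (L : List (LinOrd (1 + m + m))) → TSeparating m t L →
  (∀ ℓ → hubCrossings {m} ℓ ≤ c) → 2 * (m * pairs m) * t ≤ length L * c
separating⇒length-≥ {m} {t} {c} L separating hub≤c = begin
  2 * (m * pairs m) * t
    ≡⟨ distribute m (pairs m) t ⟩
  m * (pairs m * t) + m * (pairs m * t)
    ≤⟨ +-mono-≤
         (separated-spokes-≤ L zero (xv {m}) yv λ {i} {k} j i≢k → separating zero (xv i) (yv j) (xv k)
           (edge⇒adj (zx i) , edge⇒adj (xy k j) ∘ sym , (λ ()) , (λ ()) , xv≢yv i j , i≢k ∘ xv-injective))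
         (separated-spokes-≤ L zero (yv {m}) xv λ {i} {k} j i≢k → separating zero (yv i) (xv j) (yv k)
           (edge⇒adj (zy i) , edge⇒adj (xy j k) , (λ ()) , (λ ()) , xv≢yv j i ∘ sym , i≢k ∘ yv-injective)) ⟩
  sum (spokeCrossings ∘ layout) + sum (spokeCrossings ∘ swapParts ∘ layout)
    ≡⟨ ∑-distrib-+ (spokeCrossings ∘ layout) (spokeCrossings ∘ swapParts ∘ layout) ⟨
  sum (hubCrossings ∘ layout)
    ≤⟨ ∑-mono-≤ (hub≤c ∘ layout) ⟩
  ∑[ s < length L ] c
    ≡⟨ ∑-const (length L) c ⟩
  length L * c ∎
  where
  open ≤-Reasoning
  layout : Fin (length L) → Layout m
  layout s = layoutOf (lookup L s)
  distribute : ∀ m k t → 2 * (m * k) * t ≡ m * (k * t) + m * (k * t)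
  distribute = solve-∀

-- Averaging over the symmetries

relabel : Permutation′ m → Permutation′ m → Layout m → Layout m
relabel σ τ ℓ = record
  { z = z ; x = x ∘ (σ ⟨$⟩ʳ_) ; y = y ∘ (τ ⟨$⟩ʳ_)
  ; x-injective = Injection.injective (↔⇒↣ σ) ∘ x-injective
  ; y-injective = Injection.injective (↔⇒↣ τ) ∘ y-injective
  ; x≢y = λ i j → x≢y (σ ⟨$⟩ʳ i) (τ ⟨$⟩ʳ j) ; x≢z = x≢z ∘ (σ ⟨$⟩ʳ_) ; y≢z = y≢z ∘ (τ ⟨$⟩ʳ_)
  ; bound = bound ; x≤bound = x≤bound ∘ (σ ⟨$⟩ʳ_) ; y≤bound = y≤bound ∘ (τ ⟨$⟩ʳ_) ; z≤bound = z≤bound }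
  where open Layout ℓ

-- Abstract, since unfolding the list of (m !)² orderings stalls the conversion checker.
abstract
  relabellings : Layout m → List (LinOrd (1 + m + m))
  relabellings {m} ℓ = tabulate {n = m ! * m !} λ s →
    uncurry (λ k l → orderOf (relabel (enumerate m k) (enumerate m l) ℓ)) (remQuot (m !) s)

  length-relabellings : (ℓ : Layout m) → length (relabellings ℓ) ≡ m ! * m !
  length-relabellings {m} ℓ = length-tabulate {n = m ! * m !} _

  countSep-relabellings : ∀ (ℓ : Layout m) a b c d → countSep (relabellings ℓ) a b c d
    ≡ ∑ₚ λ σ → ∑ₚ λ τ → let p = position (relabel σ τ ℓ) in [ sep (p a) (p b) (p c) (p d) ]
  countSep-relabellings {m} ℓ a b c d = begin
    countSep (relabellings ℓ) a b c d
      ≡⟨ countSep-tabulate (uncurry ordering ∘ remQuot (m !)) a b c d ⟩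
    ∑[ s < m ! * m ! ] [ separates (uncurry ordering (remQuot (m !) s)) a b c d ]
      ≡⟨ ∑-remQuot (λ k l → [ separates (ordering k l) a b c d ]) ⟩
    ∑[ k < m ! ] ∑[ l < m ! ] [ separates (ordering k l) a b c d ]
      ≡⟨ sum-cong-≗ (λ k → sum-cong-≗ λ l → cong [_]
           (separates-orderBy (position-injective (relabelled k l)) a b c d)) ⟩
    (∑ₚ λ σ → ∑ₚ λ τ → let p = position (relabel σ τ ℓ) in [ sep (p a) (p b) (p c) (p d) ]) ∎
    where
    open ≡-Reasoning
    relabelled : Fin (m !) → Fin (m !) → Layout m
    relabelled k l = relabel (enumerate m k) (enumerate m l) ℓ
    ordering : Fin (m !) → Fin (m !) → LinOrd (1 + m + m)
    ordering k l = orderOf (relabelled k l)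

module _ (ℓ : Layout m) where
  open Layout ℓ

  countSep-relabellings-zx : ∀ i j k → countSep (relabellings ℓ) zero (xv i) (yv j) (xv k)
    ≡ ∑ₚ λ σ → ∑ₚ λ τ → [ sep z (x (σ ⟨$⟩ʳ i)) (y (τ ⟨$⟩ʳ j)) (x (σ ⟨$⟩ʳ k)) ]
  countSep-relabellings-zx i j k = trans (countSep-relabellings ℓ zero (xv i) (yv j) (xv k))
    (∑ₚ-cong λ σ → ∑ₚ-cong λ τ → let ℓ′ = relabel σ τ ℓ in
      sep-cong refl (position-x ℓ′ i) (position-y ℓ′ j) (position-x ℓ′ k))

  countSep-relabellings-zy : ∀ i j k → countSep (relabellings ℓ) zero (yv i) (xv j) (yv k)
    ≡ ∑ₚ λ σ → ∑ₚ λ τ → [ sep z (y (τ ⟨$⟩ʳ i)) (x (σ ⟨$⟩ʳ j)) (y (τ ⟨$⟩ʳ k)) ]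
  countSep-relabellings-zy i j k = trans (countSep-relabellings ℓ zero (yv i) (xv j) (yv k))
    (∑ₚ-cong λ σ → ∑ₚ-cong λ τ → let ℓ′ = relabel σ τ ℓ in
      sep-cong refl (position-y ℓ′ i) (position-x ℓ′ j) (position-y ℓ′ k))

  countSep-relabellings-xy : ∀ i j k l → countSep (relabellings ℓ) (xv i) (yv k) (xv j) (yv l)
    ≡ ∑ₚ λ σ → ∑ₚ λ τ → [ sep (x (σ ⟨$⟩ʳ i)) (y (τ ⟨$⟩ʳ k)) (x (σ ⟨$⟩ʳ j)) (y (τ ⟨$⟩ʳ l)) ]
  countSep-relabellings-xy i j k l = trans (countSep-relabellings ℓ (xv i) (yv k) (xv j) (yv l))
    (∑ₚ-cong λ σ → ∑ₚ-cong λ τ → let ℓ′ = relabel σ τ ℓ in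
      sep-cong (position-x ℓ′ i) (position-y ℓ′ k) (position-x ℓ′ j) (position-y ℓ′ l))

module _ (ℓ : Layout (2 + n)) where
  open Layout ℓ

  ∑ₚ-spokes : ∀ {i k} j → i ≢ k →
    (∑ₚ λ σ → ∑ₚ λ τ → [ sep z (x (σ ⟨$⟩ʳ i)) (y (τ ⟨$⟩ʳ j)) (x (σ ⟨$⟩ʳ k)) ]) ≡ n ! * (suc n ! * spokeCrossings ℓ)
  ∑ₚ-spokes {i} {k} j i≢k = begin
    (∑ₚ λ σ → ∑ₚ λ τ → cross (σ ⟨$⟩ʳ i) (σ ⟨$⟩ʳ k) (τ ⟨$⟩ʳ j))
      ≡⟨ ∑ₚ-cong (λ σ → ∑ₚ-eval (cross (σ ⟨$⟩ʳ i) (σ ⟨$⟩ʳ k)) j) ⟩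
    (∑ₚ λ σ → suc n ! * sum (cross (σ ⟨$⟩ʳ i) (σ ⟨$⟩ʳ k)))
      ≡⟨ ∑ₚ-eval₂ (λ p q → suc n ! * sum (cross p q)) i≢k ⟩
    n ! * ∑≠ (λ p q → suc n ! * sum (cross p q))
      ≡⟨ cong (n ! *_) (∑≠-*ˡ (suc n !) (λ p q → sum (cross p q))) ⟩
    n ! * (suc n ! * ∑≠ (λ p q → sum (cross p q)))
      ≡⟨ cong (λ v → n ! * (suc n ! * v)) (∑-∑≠-comm λ r p q → cross p q r) ⟨
    n ! * (suc n ! * spokeCrossings ℓ) ∎
    where
    open ≡-Reasoning
    cross : Fin (2 + n) → Fin (2 + n) → Fin (2 + n) → ℕ
    cross p q r = [ sep z (x p) (y r) (x q) ]

  ∑ₚ-rim : ∀ {i j k l} → i ≢ j → k ≢ l →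
    (∑ₚ λ σ → ∑ₚ λ τ → [ sep (x (σ ⟨$⟩ʳ i)) (y (τ ⟨$⟩ʳ k)) (x (σ ⟨$⟩ʳ j)) (y (τ ⟨$⟩ʳ l)) ])
    ≡ n ! * (n ! * rimCrossings ℓ)
  ∑ₚ-rim {i} {j} {k} {l} i≢j k≢l = begin
    (∑ₚ λ σ → ∑ₚ λ τ → cross (σ ⟨$⟩ʳ i) (σ ⟨$⟩ʳ j) (τ ⟨$⟩ʳ k) (τ ⟨$⟩ʳ l))
      ≡⟨ ∑ₚ-cong (λ σ → ∑ₚ-eval₂ (cross (σ ⟨$⟩ʳ i) (σ ⟨$⟩ʳ j)) k≢l) ⟩
    (∑ₚ λ σ → n ! * ∑≠ (cross (σ ⟨$⟩ʳ i) (σ ⟨$⟩ʳ j)))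
      ≡⟨ ∑ₚ-eval₂ (λ p q → n ! * ∑≠ (cross p q)) i≢j ⟩
    n ! * ∑≠ (λ p q → n ! * ∑≠ (cross p q))
      ≡⟨ cong (n ! *_) (∑≠-*ˡ (n !) (λ p q → ∑≠ (cross p q))) ⟩
    n ! * (n ! * rimCrossings ℓ) ∎
    where
    open ≡-Reasoning
    cross : Fin (2 + n) → Fin (2 + n) → Fin (2 + n) → Fin (2 + n) → ℕ
    cross p q r s = [ sep (x p) (y r) (x q) (y s) ]

relabellings-x-spokes : (ℓ : Layout (2 + n)) → ∀ {i k} j → i ≢ k →
  countSep (relabellings ℓ) zero (xv i) (yv j) (xv k) ≡ n ! * (suc n ! * spokeCrossings ℓ)
relabellings-x-spokes ℓ {i} {k} j i≢k = trans (countSep-relabellings-zx ℓ i j k) (∑ₚ-spokes ℓ j i≢k)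

relabellings-y-spokes : (ℓ : Layout (2 + n)) → ∀ {i k} j → i ≢ k →
  countSep (relabellings ℓ) zero (yv i) (xv j) (yv k) ≡ n ! * (suc n ! * spokeCrossings (swapParts ℓ))
relabellings-y-spokes ℓ {i} {k} j i≢k = trans (countSep-relabellings-zy ℓ i j k)
  (trans (∑ₚ-comm λ σ τ → [ sep z (y (τ ⟨$⟩ʳ i)) (x (σ ⟨$⟩ʳ j)) (y (τ ⟨$⟩ʳ k)) ]) (∑ₚ-spokes (swapParts ℓ) j i≢k))
  where open Layout ℓ

relabellings-rim : (ℓ : Layout (2 + n)) → ∀ {i j k l} → i ≢ j → k ≢ l →
  countSep (relabellings ℓ) (xv i) (yv k) (xv j) (yv l) ≡ n ! * (n ! * rimCrossings ℓ)
relabellings-rim ℓ {i} {j} {k} {l} i≢j k≢l = trans (countSep-relabellings-xy ℓ i j k l) (∑ₚ-rim ℓ i≢j k≢l)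

symmetrise : Layout m → List (LinOrd (1 + m + m))
symmetrise ℓ = relabellings ℓ ++ relabellings (swapParts ℓ)

length-symmetrise : (ℓ : Layout m) → length (symmetrise ℓ) ≡ m ! * m ! + m ! * m !
length-symmetrise ℓ = trans (length-++ (relabellings ℓ))
  (cong₂ _+_ (length-relabellings ℓ) (length-relabellings (swapParts ℓ)))

symmetrise-x-spokes : (ℓ : Layout (2 + n)) → ∀ {i j k} → i ≢ k →
  countSep (symmetrise ℓ) zero (xv i) (yv j) (xv k) ≡ n ! * (suc n ! * hubCrossings ℓ)
symmetrise-x-spokes {n} ℓ {i} {j} {k} i≢k = begin
  countSep (symmetrise ℓ) zero (xv i) (yv j) (xv k)
    ≡⟨ countSep-++ (relabellings ℓ) (relabellings (swapParts ℓ)) zero (xv i) (yv j) (xv k) ⟩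
  countSep (relabellings ℓ) zero (xv i) (yv j) (xv k)
    + countSep (relabellings (swapParts ℓ)) zero (xv i) (yv j) (xv k)
    ≡⟨ cong₂ _+_ (relabellings-x-spokes ℓ j i≢k) (relabellings-x-spokes (swapParts ℓ) j i≢k) ⟩
  n ! * (suc n ! * spokeCrossings ℓ) + n ! * (suc n ! * spokeCrossings (swapParts ℓ))
    ≡⟨ factor (n !) (suc n !) (spokeCrossings ℓ) (spokeCrossings (swapParts ℓ)) ⟩
  n ! * (suc n ! * hubCrossings ℓ) ∎
  where
  open ≡-Reasoning
  factor : ∀ a b s t → a * (b * s) + a * (b * t) ≡ a * (b * (s + t))
  factor = solve-∀

symmetrise-y-spokes : (ℓ : Layout (2 + n)) → ∀ {i j k} → i ≢ k →
  countSep (symmetrise ℓ) zero (yv i) (xv j) (yv k) ≡ n ! * (suc n ! * hubCrossings ℓ)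
symmetrise-y-spokes {n} ℓ {i} {j} {k} i≢k = begin
  countSep (symmetrise ℓ) zero (yv i) (xv j) (yv k)
    ≡⟨ countSep-++ (relabellings ℓ) (relabellings (swapParts ℓ)) zero (yv i) (xv j) (yv k) ⟩
  countSep (relabellings ℓ) zero (yv i) (xv j) (yv k)
    + countSep (relabellings (swapParts ℓ)) zero (yv i) (xv j) (yv k)
    ≡⟨ cong₂ _+_ (relabellings-y-spokes ℓ j i≢k) (relabellings-y-spokes (swapParts ℓ) j i≢k) ⟩
  n ! * (suc n ! * spokeCrossings (swapParts ℓ)) + n ! * (suc n ! * spokeCrossings ℓ)
    ≡⟨ factor (n !) (suc n !) (spokeCrossings ℓ) (spokeCrossings (swapParts ℓ)) ⟩
  n ! * (suc n ! * hubCrossings ℓ) ∎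
  where
  open ≡-Reasoning
  factor : ∀ a b s t → a * (b * t) + a * (b * s) ≡ a * (b * (s + t))
  factor = solve-∀

symmetrise-rim : (ℓ : Layout (2 + n)) → ∀ {i j k l} → i ≢ j → k ≢ l →
  countSep (symmetrise ℓ) (xv i) (yv k) (xv j) (yv l) ≡ n ! * (n ! * (2 * rimCrossings ℓ))
symmetrise-rim {n} ℓ {i} {j} {k} {l} i≢j k≢l = begin
  countSep (symmetrise ℓ) (xv i) (yv k) (xv j) (yv l)
    ≡⟨ countSep-++ (relabellings ℓ) (relabellings (swapParts ℓ)) (xv i) (yv k) (xv j) (yv l) ⟩
  countSep (relabellings ℓ) (xv i) (yv k) (xv j) (yv l)
    + countSep (relabellings (swapParts ℓ)) (xv i) (yv k) (xv j) (yv l)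
    ≡⟨ cong₂ _+_ (relabellings-rim ℓ i≢j k≢l) (relabellings-rim (swapParts ℓ) i≢j k≢l) ⟩
  n ! * (n ! * rimCrossings ℓ) + n ! * (n ! * rimCrossings (swapParts ℓ))
    ≡⟨ cong (λ r → n ! * (n ! * rimCrossings ℓ) + n ! * (n ! * r)) (rimCrossings-swapParts ℓ) ⟩
  n ! * (n ! * rimCrossings ℓ) + n ! * (n ! * rimCrossings ℓ)
    ≡⟨ double (n !) (rimCrossings ℓ) ⟩
  n ! * (n ! * (2 * rimCrossings ℓ)) ∎
  where
  open ≡-Reasoning
  double : ∀ a r → a * (a * r) + a * (a * r) ≡ a * (a * (2 * r))
  double = solve-∀

symmetrise-separating : (ℓ : Layout (2 + n)) → suc n * hubCrossings ℓ ≤ 2 * rimCrossings ℓ →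
  TSeparating (2 + n) (n ! * (suc n ! * hubCrossings ℓ)) (symmetrise ℓ)
symmetrise-separating {n} ℓ hub≤rim = tSeparating-intro (symmetrise ℓ)
  (≤-reflexive ∘ sym ∘ symmetrise-x-spokes ℓ)
  (≤-reflexive ∘ sym ∘ symmetrise-y-spokes ℓ)
  (λ i≢j k≢l → ≤-trans rim-large (≤-reflexive (sym (symmetrise-rim ℓ i≢j k≢l))))
  where
  open ≤-Reasoning
  regroup : ∀ a b h → a * (b * a * h) ≡ a * (a * (b * h))
  regroup = solve-∀
  rim-large : n ! * (suc n ! * hubCrossings ℓ) ≤ n ! * (n ! * (2 * rimCrossings ℓ))
  rim-large = begin
    n ! * (suc n * n ! * hubCrossings ℓ)     ≡⟨ regroup (n !) (suc n) (hubCrossings ℓ) ⟩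
    n ! * (n ! * (suc n * hubCrossings ℓ))   ≤⟨ *-monoʳ-≤ (n !) (*-monoʳ-≤ (n !) hub≤rim) ⟩
    n ! * (n ! * (2 * rimCrossings ℓ))       ∎

symmetrise-ratio : (ℓ : Layout (2 + n)) → let m = 2 + n in
  length (symmetrise ℓ) * hubCrossings ℓ ≡ 2 * (m * pairs m) * (n ! * (suc n ! * hubCrossings ℓ))
symmetrise-ratio {n} ℓ = trans (cong (_* hubCrossings ℓ) (length-symmetrise ℓ)) (regroup (n !) n (hubCrossings ℓ))
  where
  regroup : ∀ f n h → let m = 2 + n in
    (m * (suc n * f) * (m * (suc n * f)) + m * (suc n * f) * (m * (suc n * f))) * h
    ≡ 2 * (m * (m * suc n)) * (f * (suc n * f * h))
  regroup = solve-∀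

-- Existence of π_t and the limit

Least : (ℕ → Set) → Set
Least P = ∃[ k ] (P k × (∀ j → P j → k ≤ j))

least : {P : ℕ → Set} → (∀ k → Dec (P k)) → ∀ {n} → P n → Least P
least {P} P? {n} = <-rec (λ n → P n → Least P) search n
  where
  search : ∀ n → (∀ {k} → k < n → P k → Least P) → P n → Least P
  search n rec Pn with anyUpTo? P? n
  ... | yes (k , k<n , Pk) = rec k<n Pk
  ... | no  none           = n , Pn , λ j Pj → ≮⇒≥ λ j<n → none (j , j<n , Pj)

tSeparating? : ∀ m t L → Dec (TSeparating m t L)
tSeparating? m t L = all? λ a → all? λ b → all? λ c → all? λ d →
  (¬? (part m a ≟ part m b) ×-dec ¬? (part m c ≟ part m d) ×-dec
   ¬? (a ≟ᶠ c) ×-dec ¬? (a ≟ᶠ d) ×-dec ¬? (b ≟ᶠ c) ×-dec ¬? (b ≟ᶠ d))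
  →-dec (t ≤? countSep L a b c d)

listing : ∀ {k} → (Fin k → Fin (n !)) → List (LinOrd n)
listing {n} F = tabulate (enumerate n ∘ F)

countSep-listing : (L : List (LinOrd n)) →
  ∃[ F ] (∀ a b c d → countSep (listing {k = length L} F) a b c d ≡ countSep L a b c d)
countSep-listing {n} L = F , λ a b c d → begin
  countSep (listing F) a b c d
    ≡⟨ countSep-tabulate (enumerate n ∘ F) a b c d ⟩
  ∑[ s < length L ] [ separates (enumerate n (F s)) a b c d ]
    ≡⟨ sum-cong-≗ (λ s → sep-cong (pos≡ s a) (pos≡ s b) (pos≡ s c) (pos≡ s d)) ⟩
  ∑[ s < length L ] [ separates (lookup L s) a b c d ]
    ≡⟨ countSep-lookup L a b c d ⟨
  countSep L a b c d ∎
  where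
  open ≡-Reasoning
  F : Fin (length L) → Fin (n !)
  F s = proj₁ (enumerate-surjective (lookup L s))
  pos≡ : ∀ s v → pos (enumerate n (F s)) v ≡ pos (lookup L s) v
  pos≡ s v = cong toℕ (proj₂ (enumerate-surjective (lookup L s)) v)

separating-listing? : ∀ m t k → Dec (∃[ F ] TSeparating m t (listing {k = k} F))
separating-listing? m t k = map′
  (λ (code , sep) → finToFun code , sep)
  (λ (F , sep) → funToFin F ,
    subst (TSeparating m t) (tabulate-cong (cong (enumerate (1 + m + m)) ∘ sym ∘ finToFun-funToFin F)) sep)
  (any? λ code → tSeparating? m t (listing {k = k} (finToFun code)))

separating⇒isPiT : ∀ {t} (L : List (LinOrd (1 + m + m))) → TSeparating m t L → ∃[ k ] IsPiT m t k
separating⇒isPiT {m} {t} L separating =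
  let k , (F , F-separating) , minimal = least (separating-listing? m t) (relist L separating)
  in  k , (listing F , length-tabulate (enumerate (1 + m + m) ∘ F) , F-separating)
        , λ M sep → minimal (length M) (relist M sep)
  where
  relist : ∀ M → TSeparating m t M → ∃[ F ] TSeparating m t (listing {k = length M} F)
  relist M sep = let F , countSep≡ = countSep-listing M in
    F , λ a b c d ab|cd → subst (t ≤_) (sym (countSep≡ a b c d)) (sep a b c d ab|cd)

copies : ∀ {A : Set} → ℕ → List A → List A
copies k L = concat (replicate k L)

length-copies : ∀ {A : Set} k (L : List A) → length (copies k L) ≡ k * length L
length-copies zero    L = refl
length-copies (suc k) L = trans (length-++ L) (cong (length L +_) (length-copies k L))

countSep-copies : ∀ k (L : List (LinOrd n)) a b c d → countSep (copies k L) a b c d ≡ k * countSep L a b c d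
countSep-copies zero    L a b c d = refl
countSep-copies (suc k) L a b c d = trans (countSep-++ L (copies k L) a b c d)
                                          (cong (countSep L a b c d +_) (countSep-copies k L a b c d))

copies-separating : ∀ {t} k L → TSeparating m t L → TSeparating m (k * t) (copies k L)
copies-separating k L separating a b c d ab|cd =
  ≤-trans (*-monoʳ-≤ k (separating a b c d ab|cd)) (≤-reflexive (sym (countSep-copies k L a b c d)))

separating-weaken : ∀ {s t} L → s ≤ t → TSeparating m t L → TSeparating m s L
separating-weaken L s≤t separating a b c d ab|cd = ≤-trans s≤t (separating a b c d ab|cd)

/-mono-≤ : ∀ a b c d .{{_ : NonZero b}} .{{_ : NonZero d}} → a * d ≤ c * b → (ℤ.+ a) / b ≤ℚ (ℤ.+ c) / d
/-mono-≤ a (suc b) c (suc d) ad≤cb = ℚ.toℚᵘ-cancel-≤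
  (ℚᵘ.≤-respˡ-≃ (ℚᵘ.≃-sym (ℚ.toℚᵘ-fromℚᵘ (mkℚᵘ (ℤ.+ a) b)))
  (ℚᵘ.≤-respʳ-≃ (ℚᵘ.≃-sym (ℚ.toℚᵘ-fromℚᵘ (mkℚᵘ (ℤ.+ c) d)))
  (*≤* (subst₂ ℤ._≤_ (ℤ.pos-* a (suc d)) (ℤ.pos-* c (suc b)) (ℤ.+≤+ ad≤cb)))))

/-cross-≡ : ∀ a b c d .{{_ : NonZero b}} .{{_ : NonZero d}} → a * d ≡ c * b → (ℤ.+ a) / b ≡ (ℤ.+ c) / d
/-cross-≡ a b c d ad≡cb = ℚ.≤-antisym
  (/-mono-≤ a b c d (≤-reflexive ad≡cb))
  (/-mono-≤ c d a b (≤-reflexive (sym ad≡cb)))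

p-q≤p : ∀ p q .{{_ : Positive q}} → p - q ≤ℚ p
p-q≤p p q = subst (p - q ≤ℚ_) (ℚ.+-identityʳ p) (ℚ.+-monoʳ-≤ p (ℚ.neg-antimono-≤ (ℚ.<⇒≤ (ℚ.positive⁻¹ q))))

p≤p+q : ∀ p q .{{_ : Positive q}} → p ≤ℚ p +ℚ q
p≤p+q p q = subst (_≤ℚ p +ℚ q) (ℚ.+-identityʳ p) (ℚ.+-monoʳ-≤ p (ℚ.<⇒≤ (ℚ.positive⁻¹ q)))

-- The lower limit is attained along the multiples of r, by copies of F.
fracSepDim-intro : ∀ a b r F .{{_ : NonZero b}} .{{_ : NonZero r}} →
  (∀ {t} L → TSeparating m t L → a * t ≤ length L * b) →
  TSeparating m r F → length F * b ≡ a * r → FracSepDimIs m ((ℤ.+ a) / b)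
fracSepDim-intro {m} a b (suc r) F lower F-separating F-ratio =
    πₜ
  , (λ ε ε>0 → 0 , λ s _ k isPi → ℚ.≤-trans (p-q≤p q ε {{ε>0}}) (q≤πₜ/t s k isPi))
  , λ ε ε>0 N → let s = r + N * suc r ; k , isPi = πₜ s in
      s , ≤-trans (m≤m*n N (suc r)) (m≤n+m (N * suc r) r) , k , isPi ,
      ℚ.≤-trans (πₜ/t≤q N k isPi) (p≤p+q q ε {{ε>0}})
  where
  q = (ℤ.+ a) / b

  πₜ : ∀ s → ∃[ k ] IsPiT m (suc s) k
  πₜ s = separating⇒isPiT (copies (suc s) F)
    (separating-weaken (copies (suc s) F) (m≤m*n (suc s) (suc r)) (copies-separating (suc s) F F-separating))

  q≤πₜ/t : ∀ s k → IsPiT m (suc s) k → q ≤ℚ (ℤ.+ k) / suc s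
  q≤πₜ/t s k ((L , refl , separating) , _) = /-mono-≤ a b (length L) (suc s) (lower L separating)

  πₜ/t≤q : ∀ N k → IsPiT m (suc N * suc r) k → (ℤ.+ k) / (suc N * suc r) ≤ℚ q
  πₜ/t≤q N k (_ , minimal) = /-mono-≤ k (suc N * suc r) a b (begin
    k * b
      ≤⟨ *-monoˡ-≤ b (minimal (copies (suc N) F) (copies-separating (suc N) F F-separating)) ⟩
    length (copies (suc N) F) * b
      ≡⟨ cong (_* b) (length-copies (suc N) F) ⟩
    suc N * length F * b
      ≡⟨ *-assoc (suc N) (length F) b ⟩
    suc N * (length F * b)
      ≡⟨ cong (suc N *_) F-ratio ⟩
    suc N * (a * suc r)
      ≡⟨ x∙yz≈y∙xz *-commutativeSemigroup (suc N) a (suc r) ⟩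
    a * (suc N * suc r) ∎)
    where open ≤-Reasoning

-- The target value

-- This identity absorbs the parity of m and brings 2 ⌈m/2⌉ − 1 into the target value.
2*⌊m/2⌋*[2*⌈m/2⌉∸1]≡pairs : ∀ m → 2 * ⌊ m /2⌋ * (2 * ⌈ m /2⌉ ∸ 1) ≡ pairs m
2*⌊m/2⌋*[2*⌈m/2⌉∸1]≡pairs zero          = refl
2*⌊m/2⌋*[2*⌈m/2⌉∸1]≡pairs (suc zero)    = refl
2*⌊m/2⌋*[2*⌈m/2⌉∸1]≡pairs (suc (suc zero)) = refl
2*⌊m/2⌋*[2*⌈m/2⌉∸1]≡pairs (suc (suc m@(suc n))) = begin
  2 * suc a * (suc b + (suc (suc b) + 0))
    ≡⟨ expand a b ⟩
  2 * a * (b + (suc b + 0)) + (4 * (b + a) + 6)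
    ≡⟨ cong₂ (λ p k → p + (4 * k + 6)) (2*⌊m/2⌋*[2*⌈m/2⌉∸1]≡pairs m) (⌊n/2⌋+⌈n/2⌉≡n n) ⟩
  suc n * n + (4 * n + 6)
    ≡⟨ collect n ⟩
  suc (suc m) * suc m ∎
  where
  open ≡-Reasoning
  a = ⌈ n /2⌉
  b = ⌊ n /2⌋
  expand : ∀ a b → 2 * suc a * (suc b + (suc (suc b) + 0)) ≡ 2 * a * (b + (suc b + 0)) + (4 * (b + a) + 6)
  expand = solve-∀
  collect : ∀ n → suc n * n + (4 * n + 6) ≡ suc (suc (suc n)) * suc (suc n)
  collect = solve-∀

2*halvesProduct≤pairs : ∀ m → 2 * halvesProduct m ≤ pairs m
2*halvesProduct≤pairs zero    = z≤n
2*halvesProduct≤pairs m@(suc n) = begin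
  2 * (⌊ m /2⌋ * ⌈ m /2⌉)
    ≡⟨ *-assoc 2 ⌊ m /2⌋ ⌈ m /2⌉ ⟨
  2 * ⌊ m /2⌋ * suc ⌊ n /2⌋
    ≤⟨ *-monoʳ-≤ (2 * ⌊ m /2⌋) (≤-trans (≤-reflexive (sym (+-identityʳ _))) (m≤n+m _ ⌊ n /2⌋)) ⟩
  2 * ⌊ m /2⌋ * (2 * ⌈ m /2⌉ ∸ 1)
    ≡⟨ 2*⌊m/2⌋*[2*⌈m/2⌉∸1]≡pairs m ⟩
  pairs m ∎
  where open ≤-Reasoning

3*2∑squares : ∀ n → 3 * 2∑squares (suc n) ≡ pairs (suc n) * (2 * n + 1)
3*2∑squares zero    = refl
3*2∑squares (suc n) = begin
  3 * (2 * (suc n * suc n) + 2∑squares (suc n))              ≡⟨ *-distribˡ-+ 3 (2 * (suc n * suc n)) _ ⟩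
  3 * (2 * (suc n * suc n)) + 3 * 2∑squares (suc n)          ≡⟨ cong (3 * (2 * (suc n * suc n)) +_) (3*2∑squares n) ⟩
  3 * (2 * (suc n * suc n)) + suc n * n * (2 * n + 1)        ≡⟨ collect n ⟩
  suc (suc n) * suc n * (2 * suc n + 1)                      ∎
  where
  open ≡-Reasoning
  collect : ∀ n → 3 * (2 * (suc n * suc n)) + suc n * n * (2 * n + 1) ≡ suc (suc n) * suc n * (2 * suc n + 1)
  collect = solve-∀

6*prefixSum-2∑squares : ∀ n → 6 * prefixSum 2∑squares (suc n) ≡ pairs (suc n) * pairs n
6*prefixSum-2∑squares zero    = refl
6*prefixSum-2∑squares (suc n) = begin
  6 * (2∑squares (suc n) + prefixSum 2∑squares (suc n))
    ≡⟨ distribute (2∑squares (suc n)) (prefixSum 2∑squares (suc n)) ⟩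
  2 * (3 * 2∑squares (suc n)) + 6 * prefixSum 2∑squares (suc n)
    ≡⟨ cong₂ (λ s t → 2 * s + t) (3*2∑squares n) (6*prefixSum-2∑squares n) ⟩
  2 * (p * (2 * n + 1)) + p * pairs n
    ≡⟨ factor p n (pairs n) ⟩
  p * (pairs n + n + (3 * n + 2))
    ≡⟨ cong (λ s → p * (s + (3 * n + 2))) (pairs+n≡n*n n) ⟩
  p * (n * n + (3 * n + 2))
    ≡⟨ collect n p ⟩
  pairs (suc (suc n)) * p ∎
  where
  open ≡-Reasoning
  p = pairs (suc n)
  distribute : ∀ s t → 6 * (s + t) ≡ 2 * (3 * s) + 6 * t
  distribute = solve-∀
  factor : ∀ p n q → 2 * (p * (2 * n + 1)) + p * q ≡ p * (q + n + (3 * n + 2))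
  factor = solve-∀
  collect : ∀ n p → p * (n * n + (3 * n + 2)) ≡ suc (suc n) * suc n * p
  collect = solve-∀

balanced : ∀ m → Layout m
balanced m = alternating (⌊n/2⌋≤n m)

maxHubCrossings : ℕ → ℕ
maxHubCrossings m = hubCrossings (balanced m)

hubCrossings-balanced : ∀ m → 2 * maxHubCrossings m + 2∑squares m ≡ 2 * (m * pairs m) + 2 * halvesProduct m
hubCrossings-balanced m = trans (Alternating.hubCrossings-alternating (⌊n/2⌋≤n m))
  (cong (λ k → 2 * (m * pairs m) + 2 * (⌊ m /2⌋ * k)) m∸⌊m/2⌋≡⌈m/2⌉)
  where
  m∸⌊m/2⌋≡⌈m/2⌉ : m ∸ ⌊ m /2⌋ ≡ ⌈ m /2⌉
  m∸⌊m/2⌋≡⌈m/2⌉ = trans (cong (_∸ ⌊ m /2⌋) (sym (⌊n/2⌋+⌈n/2⌉≡n m))) (m+n∸m≡n ⌊ m /2⌋ ⌈ m /2⌉)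

hubCrossings≤max : (ℓ : Layout m) → hubCrossings ℓ ≤ maxHubCrossings m
hubCrossings≤max {m} ℓ = *-cancelˡ-≤ 2 (+-cancelʳ-≤ (2∑squares m) _ _
  (≤-trans (hubCrossings-upperBound ℓ) (≤-reflexive (sym (hubCrossings-balanced m)))))

6*maxHubCrossings : ∀ n → 6 * maxHubCrossings (suc n) ≡ pairs (suc n) * (4 * suc n + 1) + 6 * halvesProduct (suc n)
6*maxHubCrossings n = +-cancelʳ-≡ (p * (2 * n + 1)) _ _ (begin
  6 * hub + p * (2 * n + 1)                         ≡⟨ cong (6 * hub +_) (3*2∑squares n) ⟨
  6 * hub + 3 * 2∑squares (suc n)                   ≡⟨ factor hub (2∑squares (suc n)) ⟩
  3 * (2 * hub + 2∑squares (suc n))                 ≡⟨ cong (3 *_) (hubCrossings-balanced (suc n)) ⟩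
  3 * (2 * (suc n * p) + 2 * halvesProduct (suc n)) ≡⟨ collect n p (halvesProduct (suc n)) ⟩
  p * (4 * suc n + 1) + 6 * halvesProduct (suc n) + p * (2 * n + 1) ∎)
  where
  open ≡-Reasoning
  p = pairs (suc n)
  hub = maxHubCrossings (suc n)
  factor : ∀ h s → 6 * h + 3 * s ≡ 3 * (2 * h + s)
  factor = solve-∀
  collect : ∀ n p b → 3 * (2 * (suc n * p) + 2 * b) ≡ p * (4 * suc n + 1) + 6 * b + p * (2 * n + 1)
  collect = solve-∀

maxHubCrossings-nonZero : ∀ n → NonZero (maxHubCrossings (2 + n))
maxHubCrossings-nonZero n = ≢-nonZero λ hub≡0 →
  contradiction (trans (sym (6*maxHubCrossings (suc n))) (cong (6 *_) hub≡0)) λ ()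

maxHubCrossings-target : ∀ m → 24 * m * (2 * ⌈ m /2⌉ ∸ 1) * maxHubCrossings m
                             ≡ 2 * (m * pairs m) * suc ((8 * m + 5) * (2 * ⌈ m /2⌉ ∸ 1) + 2)
maxHubCrossings-target zero      = refl
maxHubCrossings-target m@(suc n) = begin
  24 * m * 2b+1 * hub
    ≡⟨ factor m 2b+1 hub ⟩
  4 * m * 2b+1 * (6 * hub)
    ≡⟨ cong (4 * m * 2b+1 *_) (6*maxHubCrossings n) ⟩
  4 * m * 2b+1 * (pairs m * (4 * m + 1) + 6 * (a * suc b))
    ≡⟨ isolate m 2b+1 (pairs m) a b ⟩
  4 * m * 2b+1 * (pairs m * (4 * m + 1)) + 12 * m * suc b * (2 * a * 2b+1)
    ≡⟨ cong (λ p → 4 * m * 2b+1 * (pairs m * (4 * m + 1)) + 12 * m * suc b * p) (2*⌊m/2⌋*[2*⌈m/2⌉∸1]≡pairs m) ⟩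
  4 * m * 2b+1 * (pairs m * (4 * m + 1)) + 12 * m * suc b * pairs m
    ≡⟨ collect m (pairs m) b ⟩
  2 * (m * pairs m) * suc ((8 * m + 5) * 2b+1 + 2) ∎
  where
  open ≡-Reasoning
  hub = maxHubCrossings m
  a = ⌊ m /2⌋
  b = ⌊ n /2⌋
  2b+1 = 2 * ⌈ m /2⌉ ∸ 1
  factor : ∀ m d h → 24 * m * d * h ≡ 4 * m * d * (6 * h)
  factor = solve-∀
  isolate : ∀ m d p a b → 4 * m * d * (p * (4 * m + 1) + 6 * (a * suc b))
                        ≡ 4 * m * d * (p * (4 * m + 1)) + 12 * m * suc b * (2 * a * d)
  isolate = solve-∀
  collect : ∀ m p b → 4 * m * (b + (suc b + 0)) * (p * (4 * m + 1)) + 12 * m * suc b * p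
                    ≡ 2 * (m * p) * suc ((8 * m + 5) * (b + (suc b + 0)) + 2)
  collect = solve-∀

targetValue≡ : .{{_ : NonZero (maxHubCrossings m)}} → targetValue m ≡ (ℤ.+ (2 * (m * pairs m))) / maxHubCrossings m
targetValue≡ {m} = /-cross-≡ (24 * m * (2 * ⌈ m /2⌉ ∸ 1)) _ (2 * (m * pairs m)) _ (maxHubCrossings-target m)

rimCrossings-balanced : ∀ m → 2 * rimCrossings (balanced m) + 2 * prefixSum 2∑squares m ≡ pairs m * pairs m
rimCrossings-balanced m = trans
  (cong (λ s → 2 * rimCrossings (balanced m) + 2 * s) (sym (Alternating.∑≠-outside-alternating (⌊n/2⌋≤n m))))
  (rimCrossings+outside (balanced m))

hub≤rim-balanced : ∀ n → n * maxHubCrossings (suc n) ≤ 2 * rimCrossings (balanced (suc n))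
hub≤rim-balanced n = *-cancelˡ-≤ 6 (+-cancelʳ-≤ (2 * (p * pairs n)) _ _ (begin
  6 * (n * hub) + 2 * (p * pairs n)
    ≡⟨ cong (_+ 2 * (p * pairs n)) (x∙yz≈y∙xz *-commutativeSemigroup 6 n hub) ⟩
  n * (6 * hub) + 2 * (p * pairs n)
    ≡⟨ cong (λ h → n * h + 2 * (p * pairs n)) (6*maxHubCrossings n) ⟩
  n * (p * (4 * suc n + 1) + 6 * halvesProduct (suc n)) + 2 * (p * pairs n)
    ≡⟨ cong (λ s → n * (p * (4 * suc n + 1) + s) + 2 * (p * pairs n)) (*-assoc 3 2 (halvesProduct (suc n))) ⟩
  n * (p * (4 * suc n + 1) + 3 * (2 * halvesProduct (suc n))) + 2 * (p * pairs n)
    ≤⟨ +-monoˡ-≤ (2 * (p * pairs n)) (*-monoʳ-≤ n (+-monoʳ-≤ (p * (4 * suc n + 1))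
         (*-monoʳ-≤ 3 (2*halvesProduct≤pairs (suc n))))) ⟩
  n * (p * (4 * suc n + 1) + 3 * p) + 2 * (p * pairs n)
    ≡⟨ factor n p (pairs n) ⟩
  p * (4 * (n * n) + 6 * n + 2 * (pairs n + n))
    ≡⟨ cong (λ s → p * (4 * (n * n) + 6 * n + 2 * s)) (pairs+n≡n*n n) ⟩
  p * (4 * (n * n) + 6 * n + 2 * (n * n))
    ≡⟨ collect n p ⟩
  6 * (p * (suc n * n))
    ≡⟨ cong (6 *_) (rimCrossings-balanced (suc n)) ⟨
  6 * (2 * rim + 2 * outer)
    ≡⟨ distribute rim outer ⟩
  6 * (2 * rim) + 2 * (6 * outer)
    ≡⟨ cong (λ s → 6 * (2 * rim) + 2 * s) (6*prefixSum-2∑squares n) ⟩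
  6 * (2 * rim) + 2 * (p * pairs n) ∎))
  where
  open ≤-Reasoning
  p = pairs (suc n)
  hub = maxHubCrossings (suc n)
  rim = rimCrossings (balanced (suc n))
  outer = prefixSum 2∑squares (suc n)
  factor : ∀ n p q → n * (p * (4 * suc n + 1) + 3 * p) + 2 * (p * q) ≡ p * (4 * (n * n) + 6 * n + 2 * (q + n))
  factor = solve-∀
  collect : ∀ n p → p * (4 * (n * n) + 6 * n + 2 * (n * n)) ≡ 6 * (p * (suc n * n))
  collect = solve-∀
  distribute : ∀ b w → 6 * (2 * b + 2 * w) ≡ 6 * (2 * b) + 2 * (6 * w)
  distribute = solve-∀

mainTheorem13 : (m : ℕ) → 2 ≤ m → FracSepDimIs m (targetValue m)
mainTheorem13 (suc zero) (s≤s ())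
mainTheorem13 m@(suc (suc n)) _ = subst (FracSepDimIs m) (sym (targetValue≡ {m}))
  (fracSepDim-intro (2 * (m * pairs m)) (maxHubCrossings m) multiplicity (symmetrise (balanced m))
    (λ L separating → separating⇒length-≥ L separating hubCrossings≤max)
    (symmetrise-separating (balanced m) (hub≤rim-balanced (suc n)))
    (symmetrise-ratio (balanced m)))
  where
  multiplicity : ℕ
  multiplicity = n ! * (suc n ! * maxHubCrossings m)
  instance
    hub≢0 : NonZero (maxHubCrossings m)
    hub≢0 = maxHubCrossings-nonZero n
    multiplicity≢0 : NonZero multiplicity
    multiplicity≢0 = m*n≢0 (n !) _ {{n !≢0}} {{m*n≢0 (suc n !) _ {{suc n !≢0}}}}
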